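{- The generating function $R(x)=\sum_{n\geq 0}|I_n(102,021)|\,x^{n+1}$ is given by $$R(x)=\frac{1-\sqrt{1-4x}}{2x(1-x)}+\frac{(2x^2-2x+1)(x^3-2x^2+3x-1)}{(1-x)^4(1-2x)}.$$ Moreover, for all $n\ge 1$, $$|I_{n-1}(102,021)|=\sum_{k=0}^n\frac{1}{k+1}\binom{2k}{k}-1-\frac16 n^3-\frac{11}{6}n+2^n.$$
   Context: For $n\ge 0$, $I_n$ denotes the set of inversion sequences $e=e_0e_1\cdots e_n$, i.e. integer sequences with $0\le e_i\le i$ for each $0\le i\le n$ (so elements of $I_n$ have $n+1$ letters). An inversion sequence contains a pattern (word) $\tau$ of length $k$ if it has a subsequence (not necessarily consecutive) of length $k$ that is order isomorphic to $\tau$ (same relative order, including equalities); otherwise it avoids $\tau$. $I_n(\tau_1,\dots,\tau_m)$ is the set of $e\in I_n$ avoiding all of $\tau_1,\dots,\tau_m$. Generating functions are formal power series in $x$ (with $\sqrt{\cdot}$ having constant term $1$). -}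

module Defs where

open import Algebra.Definitions.RawMonoid using (sum)
open import Data.Fin.Base as Fin using (Fin; toℕ; fromℕ; inject₁)
open import Data.Fin.Properties as Fin using (all?; any?; toℕ-fromℕ; toℕ-inject₁)
open import Data.Fin.Relation.Unary.Top using (view; ‵fromℕ; ‵inj₁)
open import Data.Integer.Base using (+_)
open import Data.List.Base as List using (List; []; _∷_; length; upTo; filter; cartesianProductWith)
open import Data.List.Membership.Propositional using (_∈_)
open import Data.List.Membership.Propositional.Properties using (∈-cartesianProductWith⁺; ∈-cartesianProductWith⁻; ∈-upTo⁺; ∈-upTo⁻)
open import Data.List.Relation.Unary.All using (All)
import Data.List.Relation.Unary.All as All
import Data.List.Relation.Unary.AllPairs as AllPairs
open import Data.List.Relation.Unary.Any using (here)
open import Data.List.Relation.Unary.Unique.Propositional using (Unique)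
open import Data.List.Relation.Unary.Unique.Propositional.Properties using (cartesianProductWith⁺; upTo⁺)
open import Data.Nat.Base as ℕ using (ℕ; zero; suc; _∸_; s≤s⁻¹; s≤s)
import Data.Nat.Properties as ℕ
open import Data.Product.Base using (_×_; _,_; ∃)
open import Data.Rational.Base as ℚ using (ℚ; 0ℚ; 1ℚ; +-0-rawMonoid)
open import Data.Vec.Base as Vec using (Vec; []; _∷_; _∷ʳ_; initLast)
open import Data.Vec.Properties using (∷ʳ-injective)
open import Function.Base using (_∘_)
open import Function.Bundles using (_⇔_; mk⇔; Equivalence)
open import Relation.Binary.PropositionalEquality using (_≡_; refl; sym; subst; subst₂)
open import Relation.Nullary using (¬_; Dec; ¬?; _×-dec_; _→-dec_)
open import Relation.Nullary.Decidable using (map′)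
open import Relation.Unary using (Decidable)

OrderIsomorphic : ∀ {k} → (Fin k → ℕ) → (Fin k → ℕ) → Set
OrderIsomorphic u v = ∀ i j → (u i ℕ.< u j ⇔ v i ℕ.< v j) × (u i ≡ u j ⇔ v i ≡ v j)

StrictlyIncreasing : ∀ {k m} → Vec (Fin m) k → Set
StrictlyIncreasing p = ∀ i j → i Fin.< j → Vec.lookup p i Fin.< Vec.lookup p j

-- p lists the positions of a subsequence of e that is order isomorphic to τ.
IsOccurrence : ∀ {m} (τ : List ℕ) → Vec ℕ m → Vec (Fin m) (length τ) → Set
IsOccurrence τ e p =
  StrictlyIncreasing p × OrderIsomorphic (Vec.lookup e ∘ Vec.lookup p) (List.lookup τ)

Contains : ∀ {m} → List ℕ → Vec ℕ m → Set
Contains τ e = ∃ (IsOccurrence τ e)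

Avoids : ∀ {m} → List ℕ → Vec ℕ m → Set
Avoids τ e = ¬ Contains τ e

AvoidsAll : ∀ {m} → List (List ℕ) → Vec ℕ m → Set
AvoidsAll τs e = All (λ τ → Avoids τ e) τs

private
  _⇔?_ : ∀ {A B : Set} → Dec A → Dec B → Dec (A ⇔ B)
  a? ⇔? b? = map′ (λ (f , g) → mk⇔ f g) (λ h → Equivalence.to h , Equivalence.from h)
                  ((a? →-dec b?) ×-dec (b? →-dec a?))

  anyVec? : ∀ {m k} {P : Vec (Fin m) k → Set} → Decidable P → Dec (∃ P)
  anyVec? {k = zero}  P? = map′ (λ p → [] , p) (λ { ([] , p) → p }) (P? [])
  anyVec? {k = suc k} P? =
    map′ (λ (i , v , p) → (i ∷ v) , p) (λ { ((i ∷ v) , p) → i , v , p })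
         (any? λ i → anyVec? λ v → P? (i ∷ v))

isOccurrence? : ∀ {m} τ (e : Vec ℕ m) → Decidable (IsOccurrence τ e)
isOccurrence? τ e p =
  (all? λ i → all? λ j → (i Fin.<? j) →-dec (Vec.lookup p i Fin.<? Vec.lookup p j))
  ×-dec
  (all? λ i → all? λ j → ((u i ℕ.<? u j) ⇔? (v i ℕ.<? v j)) ×-dec ((u i ℕ.≟ u j) ⇔? (v i ℕ.≟ v j)))
  where
  u = Vec.lookup e ∘ Vec.lookup p
  v = List.lookup τ

avoidsAll? : ∀ {m} τs → Decidable (AvoidsAll {m} τs)
avoidsAll? τs e = All.all? (λ τ → ¬? (anyVec? (isOccurrence? τ e))) τs

IsInversionSequence : ∀ {m} → Vec ℕ m → Set
IsInversionSequence e = ∀ i → Vec.lookup e i ℕ.≤ toℕ i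

-- Indexed by the number of letters, so I_n is enumerated by inversionSequences (suc n).
inversionSequences : ∀ m → List (Vec ℕ m)
inversionSequences zero    = [] ∷ []
inversionSequences (suc m) = cartesianProductWith _∷ʳ_ (inversionSequences m) (upTo (suc m))

-- |I_n(τ₁,…,τ_r)|.  By the lemmas below, inversionSequences enumerates the
-- inversion sequences without repetition, so this length is a cardinality.
∣I∣ : ℕ → List (List ℕ) → ℕ
∣I∣ n τs = length (filter (avoidsAll? τs) (inversionSequences (suc n)))

private
  lookup-∷ʳ-inject₁ : ∀ {m} (e : Vec ℕ m) a i → Vec.lookup (e ∷ʳ a) (inject₁ i) ≡ Vec.lookup e i
  lookup-∷ʳ-inject₁ (x ∷ e) a Fin.zero    = refl
  lookup-∷ʳ-inject₁ (x ∷ e) a (Fin.suc i) = lookup-∷ʳ-inject₁ e a i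

  lookup-∷ʳ-fromℕ : ∀ {m} (e : Vec ℕ m) a → Vec.lookup (e ∷ʳ a) (fromℕ m) ≡ a
  lookup-∷ʳ-fromℕ []      a = refl
  lookup-∷ʳ-fromℕ (x ∷ e) a = lookup-∷ʳ-fromℕ e a

inversionSequences-sound : ∀ {m} {e : Vec ℕ m} → e ∈ inversionSequences m → IsInversionSequence e
inversionSequences-sound {zero} _ ()
inversionSequences-sound {suc m} e∈ i
  with e′ , a , e′∈ , a∈ , refl ← ∈-cartesianProductWith⁻ _∷ʳ_ (inversionSequences m) (upTo (suc m)) e∈
  with view i
... | ‵fromℕ =
  subst₂ ℕ._≤_ (sym (lookup-∷ʳ-fromℕ e′ a)) (sym (toℕ-fromℕ m)) (s≤s⁻¹ (∈-upTo⁻ a∈))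
... | ‵inj₁ {i = j} _ =
  subst₂ ℕ._≤_ (sym (lookup-∷ʳ-inject₁ e′ a j)) (sym (toℕ-inject₁ j)) (inversionSequences-sound e′∈ j)

inversionSequences-complete : ∀ {m} {e : Vec ℕ m} → IsInversionSequence e → e ∈ inversionSequences m
inversionSequences-complete {zero} {[]} _ = here refl
inversionSequences-complete {suc m} {e} inv with e′ , a , refl ← initLast e =
  ∈-cartesianProductWith⁺ _∷ʳ_
    (inversionSequences-complete λ j →
      subst₂ ℕ._≤_ (lookup-∷ʳ-inject₁ e′ a j) (toℕ-inject₁ j) (inv (inject₁ j)))
    (∈-upTo⁺ (s≤s (subst₂ ℕ._≤_ (lookup-∷ʳ-fromℕ e′ a) (toℕ-fromℕ m) (inv (fromℕ m)))))

inversionSequences-unique : ∀ m → Unique (inversionSequences m)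
inversionSequences-unique zero    = All.[] AllPairs.∷ AllPairs.[]
inversionSequences-unique (suc m) =
  cartesianProductWith⁺ _∷ʳ_ (λ {w} {x} → ∷ʳ-injective w x)
    (inversionSequences-unique m) (upTo⁺ (suc m))

fromℕℚ : ℕ → ℚ
fromℕℚ n = + n ℚ./ 1

∑ : ∀ {n} → (Fin n → ℚ) → ℚ
∑ = sum +-0-rawMonoid

PowerSeries : Set
PowerSeries = ℕ → ℚ

infix  4 _≈ₛ_
infixl 6 _+ₛ_ _-ₛ_
infixl 7 _*ₛ_
infixr 8 _^ₛ_

_≈ₛ_ : PowerSeries → PowerSeries → Set
f ≈ₛ g = ∀ n → f n ≡ g n

_+ₛ_ _-ₛ_ _*ₛ_ : PowerSeries → PowerSeries → PowerSeries
(f +ₛ g) n = f n ℚ.+ g n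
(f -ₛ g) n = f n ℚ.- g n
(f *ₛ g) n = ∑ {suc n} λ k → f (toℕ k) ℚ.* g (n ∸ toℕ k)

const : ℕ → PowerSeries
const c zero    = fromℕℚ c
const c (suc _) = 0ℚ

x : PowerSeries
x 1 = 1ℚ
x _ = 0ℚ

_^ₛ_ : PowerSeries → ℕ → PowerSeries
f ^ₛ zero  = const 1
f ^ₛ suc k = f *ₛ f ^ₛ k

-- s = √f, on the branch with constant term 1; this determines s.
IsSqrt : PowerSeries → PowerSeries → Set
IsSqrt s f = s 0 ≡ 1ℚ × s *ₛ s ≈ₛ f

-- q = f / g.  Since ℚ[[x]] is an integral domain, this determines q, also when
-- g has constant term 0 and so is not invertible.
IsQuotient : PowerSeries → PowerSeries → PowerSeries → Set
IsQuotient q f g = ¬ (g ≈ₛ const 0) × q *ₛ g ≈ₛ f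

patterns : List (List ℕ)
patterns = (1 ∷ 0 ∷ 2 ∷ []) ∷ (0 ∷ 2 ∷ 1 ∷ []) ∷ []

-- R(x) = ∑_{n≥0} |I_n(102,021)| x^{n+1}; note the shifted exponent.
R : PowerSeries
R zero    = 0ℚ
R (suc n) = fromℕℚ (∣I∣ n patterns)

{-# OPTIONS --safe #-}
module Submission where

-- An inversion sequence starts with 0.  Hence it avoids 021 exactly when its
-- positive letters increase weakly, and then an occurrence of 102 must be a
-- positive letter, a later 0 and a still later, larger letter.  So the sequences
-- that avoid both patterns have one of three forms: zeros, then weakly
-- increasing positive letters, if any; the same followed by zeros; or a word in the
-- letters 0 and v only.  A finite automaton reading the letters from left to
-- right decides this (describes-∷, describes-state), so the count becomes the
-- number of its accepted words (∣I∣-completions).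
--
-- The number of accepted continuations of a word whose last letter v is a
-- current maximum depends only on the slack m - v, where m is the length.  For
-- words with two different positive letters it is a partial sum of ballot
-- numbers (completions-climb); with a single positive letter there are
-- 2^k - 1 - k more (completions-level).  Summing over the first positive letter
-- gives completions-zeros, in which the ballot numbers of slack 0 are the
-- Catalan numbers.  This is the counting formula.
--
-- For the generating function, the ballot series are the powers of the Catalan
-- series C (ballotSeries-*), so C = 1 + xC² and 1 - 2xC is the square root of
-- 1 - 4x.  The partial sums of the Catalan numbers have generating function
-- C / (1 - x), which is the first summand.  The rest of the formula is a cubic
-- polynomial plus a multiple of 2^n, hence satisfies the recurrence that
-- multiplication by (1 - x)⁴(1 - 2x) expresses; comparing the coefficients up to
-- degree 5 identifies the second summand.

open import Defs
open import Data.Fin.Base using (toℕ)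
open import Data.Nat.Base as ℕ using (ℕ; suc; pred; _≤_)
open import Data.Nat.Combinatorics using (_C_; nCk≡nC[n∸k]; nCk+nC[k+1]≡[n+1]C[k+1]; nC1≡n)
open import Data.Product.Base using (_×_; _,_; proj₁; proj₂; Σ-syntax)
open import Function.Base using (_∘_)
open import Relation.Binary.PropositionalEquality
open import Relation.Nullary using (contradiction)
open ≡-Reasoning

module Counting where

  open import Data.Empty using (⊥)
  open import Data.Fin.Base as Fin using (Fin; zero; suc)
  open import Data.List.Base using (List; []; _∷_; _++_; length; map; reverse; filter;
    upTo; applyUpTo; applyDownFrom; cartesianProductWith)
  open import Data.List.Membership.Propositional using (_∈_)
  open import Data.List.Membership.Propositional.Properties using (∈-cartesianProductWith⁻; ∈-upTo⁻)
  open import Data.List.Properties using (map-upTo; map-++; map-∘; map-cong; length-reverse; reverse-++)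
  open import Data.List.Relation.Binary.Sublist.Propositional
    using (_⊆_; []; _∷_; _∷ʳ_; to∈; from∈; minimum) renaming (lookup to lookup-⊆)
  open import Data.List.Relation.Binary.Sublist.Propositional.Properties using (reverse⁺; reverse⁻)
  open import Data.List.Relation.Unary.All as All using (All; []; _∷_)
  open import Data.List.Relation.Unary.Any using (here; there)
  open import Data.Nat.Base
  open import Data.Nat.ListAction using (sum)
  open import Data.Nat.ListAction.Properties using (sum-++)
  open import Data.Nat.Properties
  open import Data.Nat.Tactic.RingSolver using (solve-∀)
  open import Data.Product.Base using (∃; ∃₂)
  open import Data.Sum.Base using (_⊎_; inj₁; inj₂; [_,_]′)
  open import Data.Vec.Base as Vec using (Vec; []; _∷_; toList; lookup)
  open import Data.Vec.Properties using (toList-∷ʳ; length-toList)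
  open import Function.Bundles using (_⇔_; mk⇔; Equivalence)
  open import Relation.Binary.Definitions using (tri<; tri≈; tri>)
  open import Relation.Nullary using (¬_; yes; no)
  open import Relation.Unary using (Decidable)

  -- Ballot numbers

  -- ballot k r is the number of weakly increasing words of k letters, the i-th of
  -- them (from 0) at most r + i.  Equivalently, its generating function in k is
  -- the (r + 1)-st power of the Catalan series.
  ballot : ℕ → ℕ → ℕ
  ballot zero    r       = 1
  ballot (suc k) zero    = ballot k 1
  ballot (suc k) (suc r) = ballot (suc k) r + ballot k (suc (suc r))

  -- The binomial coefficient C(n, k - 1), which is 0 when k = 0.
  below : ℕ → ℕ → ℕ
  below n zero    = 0
  below n (suc k) = n C k

  below-pascal : ∀ n k → below n k + n C k ≡ suc n C k
  below-pascal n zero    = refl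
  below-pascal n (suc k) = nCk+nC[k+1]≡[n+1]C[k+1] n k

  central-symmetry : ∀ k → suc (k + k) C k ≡ suc (k + k) C suc k
  central-symmetry k = begin
    suc (k + k) C k                     ≡⟨ nCk≡nC[n∸k] (m≤n⇒m≤1+n (m≤m+n k k)) ⟩
    suc (k + k) C (suc (k + k) ∸ k)     ≡⟨ cong (suc (k + k) C_) (m+n∸n≡m (suc k) k) ⟩
    suc (k + k) C suc k                 ∎

  -- The reflection formula C(2k + r, k) - C(2k + r, k - 1).
  ballot-binomial : ∀ k r → ballot k r + below (k + k + r) k ≡ (k + k + r) C k
  ballot-binomial zero    r    = refl
  ballot-binomial (suc k) zero = begin
    ballot k 1 + (suc k + suc k + 0) C k         ≡⟨ cong (λ n → ballot k 1 + n C k) N≡ ⟩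
    ballot k 1 + suc N C k                       ≡⟨ cong (ballot k 1 +_) (below-pascal N k) ⟨
    ballot k 1 + (below N k + N C k)             ≡⟨ +-assoc (ballot k 1) _ _ ⟨
    ballot k 1 + below N k + N C k               ≡⟨ cong (_+ N C k) ih ⟩
    N C k + N C k                                ≡⟨ cong (N C k +_) (central-symmetry k) ⟩
    N C k + N C suc k                            ≡⟨ nCk+nC[k+1]≡[n+1]C[k+1] N k ⟩
    suc N C suc k                                ≡⟨ cong (_C suc k) N≡ ⟨
    (suc k + suc k + 0) C suc k                  ∎
    where
    N = suc (k + k)
    N≡ : suc k + suc k + 0 ≡ suc N
    N≡ = trans (+-identityʳ (suc k + suc k)) (cong suc (+-suc k k))
    ih : ballot k 1 + below N k ≡ N C k
    ih = subst (λ n → ballot k 1 + below n k ≡ n C k) (+-comm (k + k) 1) (ballot-binomial k 1)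
  ballot-binomial (suc k) (suc r) = begin
    ballot (suc k) r + ballot k (2 + r) + (suc k + suc k + suc r) C k
      ≡⟨ cong (λ n → ballot (suc k) r + ballot k (2 + r) + n C k) (+-suc (suc k + suc k) r) ⟩
    ballot (suc k) r + ballot k (2 + r) + suc N C k
      ≡⟨ cong (ballot (suc k) r + ballot k (2 + r) +_) (below-pascal N k) ⟨
    ballot (suc k) r + ballot k (2 + r) + (below N k + N C k)
      ≡⟨ regroup (ballot (suc k) r) (ballot k (2 + r)) (below N k) (N C k) ⟩
    (ballot k (2 + r) + below N k) + (ballot (suc k) r + N C k)
      ≡⟨ cong₂ _+_ ih (ballot-binomial (suc k) r) ⟩
    N C k + N C suc k
      ≡⟨ nCk+nC[k+1]≡[n+1]C[k+1] N k ⟩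
    suc N C suc k
      ≡⟨ cong (_C suc k) (+-suc (suc k + suc k) r) ⟨
    (suc k + suc k + suc r) C suc k ∎
    where
    N = suc k + suc k + r
    regroup : ∀ a b c d → a + b + (c + d) ≡ (b + c) + (a + d)
    regroup = solve-∀
    shift : ∀ k r → k + k + (2 + r) ≡ suc k + suc k + r
    shift = solve-∀
    ih : ballot k (2 + r) + below N k ≡ N C k
    ih = subst (λ n → ballot k (2 + r) + below n k ≡ n C k) (shift k r) (ballot-binomial k (2 + r))

  -- The closed form C(2k, k) / (k + 1) is suc-*-catalan below.
  catalan : ℕ → ℕ
  catalan k = ballot k 0

  -- ∑ballot k r is the sum of ballot i r over i ≤ k.
  ∑ballot : ℕ → ℕ → ℕ
  ∑ballot zero    r = 1
  ∑ballot (suc k) r = ∑ballot k r + ballot (suc k) r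

  ∑ballot-zero : ∀ k → ∑ballot (suc k) 0 ≡ suc (∑ballot k 1)
  ∑ballot-zero zero    = refl
  ∑ballot-zero (suc k) = cong (_+ ballot (suc k) 1) (∑ballot-zero k)

  ∑ballot-suc : ∀ k r → ∑ballot (suc k) (suc r) ≡ ∑ballot (suc k) r + ∑ballot k (2 + r)
  ∑ballot-suc zero    r = sym (+-assoc 1 (ballot 1 r) 1)
  ∑ballot-suc (suc k) r = begin
    ∑ballot (suc k) (suc r) + (ballot (2 + k) r + ballot (suc k) (2 + r))
      ≡⟨ cong (_+ (ballot (2 + k) r + ballot (suc k) (2 + r))) (∑ballot-suc k r) ⟩
    ∑ballot (suc k) r + ∑ballot k (2 + r) + (ballot (2 + k) r + ballot (suc k) (2 + r))
      ≡⟨ swap (∑ballot (suc k) r) _ _ _ ⟩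
    ∑ballot (suc k) r + ballot (2 + k) r + (∑ballot k (2 + r) + ballot (suc k) (2 + r)) ∎
    where
    swap : ∀ a b c d → a + b + (c + d) ≡ a + c + (b + d)
    swap = solve-∀

  -- The recursion for weakly increasing letters followed by zeros: either only
  -- zeros remain, or the next letter has distance 1, ..., r + 1 from the upper
  -- bound of the letter after it.
  ∑ballot-step : ∀ k r → ∑ballot (suc k) r ≡ suc (sum (applyDownFrom (∑ballot k ∘ suc) (suc r)))
  ∑ballot-step k zero    = trans (∑ballot-zero k) (cong suc (sym (+-identityʳ _)))
  ∑ballot-step k (suc r) = begin
    ∑ballot (suc k) (suc r)                  ≡⟨ ∑ballot-suc k r ⟩
    ∑ballot (suc k) r + ∑ballot k (2 + r)    ≡⟨ cong (_+ ∑ballot k (2 + r)) (∑ballot-step k r) ⟩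
    suc (sum (applyDownFrom (∑ballot k ∘ suc) (suc r)) + ∑ballot k (2 + r))
                                             ≡⟨ cong suc (+-comm _ (∑ballot k (2 + r))) ⟩
    suc (sum (applyDownFrom (∑ballot k ∘ suc) (2 + r))) ∎

  absorption : ∀ n k → suc k * (suc n C suc k) ≡ suc n * (n C k)
  absorption zero    zero    = refl
  absorption zero    (suc k) = *-zeroʳ k
  absorption (suc n) zero    = begin
    1 * ((2 + n) C 1)   ≡⟨ *-identityˡ ((2 + n) C 1) ⟩
    (2 + n) C 1         ≡⟨ nC1≡n (2 + n) ⟩
    2 + n               ≡⟨ *-identityʳ (2 + n) ⟨
    (2 + n) * 1         ∎
  absorption (suc n) (suc k) = begin
    (2 + k) * ((2 + n) C (2 + k))
      ≡⟨ cong ((2 + k) *_) (nCk+nC[k+1]≡[n+1]C[k+1] (suc n) (suc k)) ⟨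
    (2 + k) * (u + w)
      ≡⟨ expand k u w ⟩
    u + (suc k * u + (2 + k) * w)
      ≡⟨ cong (u +_) (cong₂ _+_ (absorption n k) (absorption n (suc k))) ⟩
    u + (suc n * (n C k) + suc n * (n C suc k))
      ≡⟨ cong (u +_) (*-distribˡ-+ (suc n) (n C k) (n C suc k)) ⟨
    u + suc n * (n C k + n C suc k)
      ≡⟨ cong (λ z → u + suc n * z) (nCk+nC[k+1]≡[n+1]C[k+1] n k) ⟩
    (2 + n) * u ∎
    where
    u = suc n C suc k
    w = suc n C (2 + k)
    expand : ∀ k u w → (2 + k) * (u + w) ≡ u + (suc k * u + (2 + k) * w)
    expand = solve-∀

  suc-*-catalan : ∀ k → suc k * catalan k ≡ (2 * k) C k
  suc-*-catalan zero    = refl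
  suc-*-catalan (suc j) = begin
    (2 + j) * c         ≡⟨ +-cancelʳ-≡ ((2 + j) * u) ((2 + j) * c) w cancelled ⟩
    w                   ≡⟨ cong (_C suc j) (double j) ⟨
    (2 * suc j) C suc j ∎
    where
    n = 2 + (j + j)
    c = catalan (suc j)
    u = n C j
    w = n C suc j
    double : ∀ j → 2 * suc j ≡ 2 + (j + j)
    double = solve-∀
    double′ : ∀ j → suc j + suc j + 0 ≡ 2 + (j + j)
    double′ = solve-∀
    c+u≡w : c + u ≡ w
    c+u≡w = subst (λ n → c + n C j ≡ n C suc j) (double′ j) (ballot-binomial (suc j) 0)
    -- Absorption at n = 2j + 2, where n - j = j + 2.
    ratio : suc j * w ≡ (2 + j) * u
    ratio = +-cancelˡ-≡ (suc j * u) (suc j * w) ((2 + j) * u) (begin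
      suc j * u + suc j * w    ≡⟨ *-distribˡ-+ (suc j) u w ⟨
      suc j * (u + w)          ≡⟨ cong (suc j *_) (nCk+nC[k+1]≡[n+1]C[k+1] n j) ⟩
      suc j * (suc n C suc j)  ≡⟨ absorption n j ⟩
      suc n * u                ≡⟨ split j u ⟩
      suc j * u + (2 + j) * u  ∎)
      where
      split : ∀ j u → (3 + (j + j)) * u ≡ suc j * u + (2 + j) * u
      split = solve-∀
    cancelled : (2 + j) * c + (2 + j) * u ≡ w + (2 + j) * u
    cancelled = begin
      (2 + j) * c + (2 + j) * u  ≡⟨ *-distribˡ-+ (2 + j) c u ⟨
      (2 + j) * (c + u)          ≡⟨ cong ((2 + j) *_) c+u≡w ⟩
      w + suc j * w              ≡⟨ cong (w +_) ratio ⟩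
      w + (2 + j) * u            ∎

  -- The automaton and the number of its accepted words

  -- The form of an inversion sequence that avoids both patterns:
  --   zeros     only zeros;
  --   level v   zeros, then a nonempty block of letters v > 0;
  --   climb v   zeros, then weakly increasing positive letters that end in v and
  --             are not all equal;
  --   mixed v   letters 0 and v > 0 only, with a 0 somewhere after a v;
  --   closing   as climb, followed by at least one 0.
  -- All other sequences are rejected.
  data State : Set where
    zeros             : State
    level climb mixed : ℕ → State
    closing rejected  : State

  -- The state after one more letter.  The middle cases compare it with v: after a
  -- zero and v, a positive letter below v makes an occurrence of 021; after v and
  -- then a zero, a letter above v makes an occurrence of 102.  In closing, a zero
  -- follows two letters 0 < b < v, and every positive letter fails one way or the
  -- other.
  δ : State → ℕ → State
  δ zeros     zero      = zeros
  δ zeros     a@(suc _) = level a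
  δ (level v) zero      = mixed v
  δ (level v) a@(suc _) with <-cmp a v
  ... | tri< _ _ _ = rejected
  ... | tri≈ _ _ _ = level v
  ... | tri> _ _ _ = climb a
  δ (climb v) zero      = closing
  δ (climb v) a@(suc _) with <-cmp a v
  ... | tri< _ _ _ = rejected
  ... | tri≈ _ _ _ = climb a
  ... | tri> _ _ _ = climb a
  δ (mixed v) zero      = mixed v
  δ (mixed v) a@(suc _) with <-cmp a v
  ... | tri< _ _ _ = rejected
  ... | tri≈ _ _ _ = mixed v
  ... | tri> _ _ _ = rejected
  δ closing   zero      = closing
  δ closing   (suc _)   = rejected
  δ rejected  _         = rejected

  δ-level-< : ∀ {a v} → suc a < v → δ (level v) (suc a) ≡ rejected
  δ-level-< {a} {v} a<v with <-cmp (suc a) v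
  ... | tri< _ _ _   = refl
  ... | tri≈ a≮v _ _ = contradiction a<v a≮v
  ... | tri> a≮v _ _ = contradiction a<v a≮v

  δ-level-≡ : ∀ a → δ (level (suc a)) (suc a) ≡ level (suc a)
  δ-level-≡ a with <-cmp (suc a) (suc a)
  ... | tri< _ a≢a _ = contradiction refl a≢a
  ... | tri≈ _ _ _   = refl
  ... | tri> _ a≢a _ = contradiction refl a≢a

  δ-level-> : ∀ {a v} → v < suc a → δ (level v) (suc a) ≡ climb (suc a)
  δ-level-> {a} {v} v<a with <-cmp (suc a) v
  ... | tri< _ _ v≮a = contradiction v<a v≮a
  ... | tri≈ _ _ v≮a = contradiction v<a v≮a
  ... | tri> _ _ _   = refl

  δ-climb-< : ∀ {a v} → suc a < v → δ (climb v) (suc a) ≡ rejected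
  δ-climb-< {a} {v} a<v with <-cmp (suc a) v
  ... | tri< _ _ _   = refl
  ... | tri≈ a≮v _ _ = contradiction a<v a≮v
  ... | tri> a≮v _ _ = contradiction a<v a≮v

  δ-climb-≥ : ∀ {a v} → v ≤ suc a → δ (climb v) (suc a) ≡ climb (suc a)
  δ-climb-≥ {a} {v} v≤a with <-cmp (suc a) v
  ... | tri< a<v _ _ = contradiction a<v (≤⇒≯ v≤a)
  ... | tri≈ _ _ _   = refl
  ... | tri> _ _ _   = refl

  δ-mixed-≡ : ∀ a → δ (mixed (suc a)) (suc a) ≡ mixed (suc a)
  δ-mixed-≡ a with <-cmp (suc a) (suc a)
  ... | tri< _ a≢a _ = contradiction refl a≢a
  ... | tri≈ _ _ _   = refl
  ... | tri> _ a≢a _ = contradiction refl a≢a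

  δ-mixed-≢ : ∀ {a v} → suc a ≢ v → δ (mixed v) (suc a) ≡ rejected
  δ-mixed-≢ {a} {v} a≢v with <-cmp (suc a) v
  ... | tri< _ _ _   = refl
  ... | tri≈ _ a≡v _ = contradiction a≡v a≢v
  ... | tri> _ _ _   = refl

  sum-applyUpTo-cong : ∀ {f g : ℕ → ℕ} n → (∀ i → f i ≡ g i) →
                       sum (applyUpTo f n) ≡ sum (applyUpTo g n)
  sum-applyUpTo-cong zero    f≡g = refl
  sum-applyUpTo-cong (suc n) f≡g = cong₂ _+_ (f≡g 0) (sum-applyUpTo-cong n (f≡g ∘ suc))

  sum-applyUpTo-≡0 : ∀ {f : ℕ → ℕ} n → (∀ i → i < n → f i ≡ 0) → sum (applyUpTo f n) ≡ 0
  sum-applyUpTo-≡0 zero    f≡0 = refl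
  sum-applyUpTo-≡0 (suc n) f≡0 =
    cong₂ _+_ (f≡0 0 z<s) (sum-applyUpTo-≡0 n (λ i i<n → f≡0 (suc i) (s<s i<n)))

  sum-applyUpTo-+ : ∀ (f : ℕ → ℕ) m n →
    sum (applyUpTo f (m + n)) ≡ sum (applyUpTo f m) + sum (applyUpTo (λ j → f (m + j)) n)
  sum-applyUpTo-+ f zero    n = refl
  sum-applyUpTo-+ f (suc m) n =
    trans (cong (f 0 +_) (sum-applyUpTo-+ (f ∘ suc) m n)) (sym (+-assoc (f 0) _ _))

  -- For a function of the next letter that vanishes strictly between 0 and c + 1:
  -- the sum over all letters up to m = c + 1 + r.
  sum-gap : ∀ (f : ℕ → ℕ) c r → (∀ i → i < c → f (suc i) ≡ 0) →
    sum (applyUpTo f (suc (suc c + r))) ≡ f 0 + sum (applyUpTo (λ j → f (suc c + j)) (suc r))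
  sum-gap f c r f≡0 = cong (f 0 +_) (begin
    sum (applyUpTo (f ∘ suc) (suc c + r))
      ≡⟨ cong (λ n → sum (applyUpTo (f ∘ suc) n)) (+-suc c r) ⟨
    sum (applyUpTo (f ∘ suc) (c + suc r))
      ≡⟨ sum-applyUpTo-+ (f ∘ suc) c (suc r) ⟩
    sum (applyUpTo (f ∘ suc) c) + sum (applyUpTo (λ j → f (suc c + j)) (suc r))
      ≡⟨ cong (_+ sum (applyUpTo (λ j → f (suc c + j)) (suc r))) (sum-applyUpTo-≡0 c f≡0) ⟩
    sum (applyUpTo (λ j → f (suc c + j)) (suc r)) ∎)

  -- If Φ m v depends only on the slack m - v, then summing over the n letters
  -- v = c + 1, ..., c + n at m = c + 1 + n is summing over the slacks n, ..., 1.
  sum-by-slack : ∀ (Φ : ℕ → ℕ → ℕ) (h : ℕ → ℕ) → (∀ c r → Φ (suc c + r) (suc c) ≡ h r) →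
    ∀ n c → sum (applyUpTo (λ j → Φ (suc c + n) (suc c + j)) n) ≡ sum (applyDownFrom (h ∘ suc) n)
  sum-by-slack Φ h Φ≡h zero    c = refl
  sum-by-slack Φ h Φ≡h (suc n) c = cong₂ _+_
    (trans (cong (Φ (suc c + suc n)) (+-identityʳ (suc c))) (Φ≡h c (suc n)))
    (trans (sum-applyUpTo-cong n (λ j → cong₂ Φ (+-suc (suc c) n) (+-suc (suc c) j)))
           (sum-by-slack Φ h Φ≡h n (suc c)))

  accept : State → ℕ
  accept rejected = 0
  accept _        = 1

  -- completions k m σ is the number of ways to append k letters to an inversion
  -- sequence with m letters in state σ, keeping it an accepted inversion sequence.
  completions : ℕ → ℕ → State → ℕ
  completions zero    m σ = accept σ
  completions (suc k) m σ = sum (applyUpTo (λ a → completions k (suc m) (δ σ a)) (suc m))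

  completions-rejected : ∀ k m → completions k m rejected ≡ 0
  completions-rejected zero    m = refl
  completions-rejected (suc k) m = sum-applyUpTo-≡0 (suc m) (λ _ _ → completions-rejected k (suc m))

  completions-via-rejected : ∀ k m {σ} → σ ≡ rejected → completions k m σ ≡ 0
  completions-via-rejected k m refl = completions-rejected k m

  completions-closing : ∀ k m → completions k m closing ≡ 1
  completions-closing zero    m = refl
  completions-closing (suc k) m =
    cong₂ _+_ (completions-closing k (suc m))
              (sum-applyUpTo-≡0 m (λ _ _ → completions-rejected k (suc m)))

  completions-mixed : ∀ k c r → completions k (suc c + r) (mixed (suc c)) ≡ 2 ^ k
  completions-mixed zero    c r = refl
  completions-mixed (suc k) c r = begin
    completions (suc k) (suc c + r) (mixed (suc c))
      ≡⟨ sum-gap f c r (λ i i<c → vanish (<⇒≢ (s<s i<c))) ⟩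
    f 0 + (f (suc c + 0) + sum (applyUpTo (λ j → f (suc c + suc j)) r))
      ≡⟨ cong₂ _+_ ih (cong₂ _+_ repeat (sum-applyUpTo-≡0 r (λ j _ → vanish (above j)))) ⟩
    2 ^ suc k ∎
    where
    f : ℕ → ℕ
    f a = completions k (suc (suc c + r)) (δ (mixed (suc c)) a)
    ih : completions k (suc (suc c + r)) (mixed (suc c)) ≡ 2 ^ k
    ih = subst (λ m → completions k m (mixed (suc c)) ≡ 2 ^ k) (+-suc (suc c) r)
           (completions-mixed k c (suc r))
    repeat : f (suc c + 0) ≡ 2 ^ k
    repeat = trans (cong f (+-identityʳ (suc c)))
                 (trans (cong (completions k _) (δ-mixed-≡ c)) ih)
    vanish : ∀ {a} → suc a ≢ suc c → f (suc a) ≡ 0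
    vanish a≢c = completions-via-rejected k _ (δ-mixed-≢ a≢c)
    above : ∀ j → suc c + suc j ≢ suc c
    above j = >⇒≢ (m<m+n (suc c) z<s)

  -- Here and for level, r = m - v is the slack of the current letter v = c + 1.
  completions-climb : ∀ k c r → completions k (suc c + r) (climb (suc c)) ≡ ∑ballot k r
  completions-climb zero    c r = refl
  completions-climb (suc k) c r = begin
    completions (suc k) (suc c + r) (climb (suc c))
      ≡⟨ sum-gap f c r (λ i i<c → completions-via-rejected k _ (δ-climb-< (s<s i<c))) ⟩
    f 0 + sum (applyUpTo (λ j → f (suc c + j)) (suc r))
      ≡⟨ cong₂ _+_ (completions-closing k _)
           (sum-applyUpTo-cong (suc r) (λ j → cong₂ (completions k)
             (sym (+-suc (suc c) r)) (δ-climb-≥ (m≤m+n (suc c) j)))) ⟩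
    suc (sum (applyUpTo (λ j → completions k (suc c + suc r) (climb (suc c + j))) (suc r)))
      ≡⟨ cong suc (sum-by-slack (λ m v → completions k m (climb v)) (∑ballot k)
           (completions-climb k) (suc r) c) ⟩
    suc (sum (applyDownFrom (∑ballot k ∘ suc) (suc r)))
      ≡⟨ ∑ballot-step k r ⟨
    ∑ballot (suc k) r ∎
    where
    f : ℕ → ℕ
    f a = completions k (suc (suc c + r)) (δ (climb (suc c)) a)

  -- The number 2 ^ k - 1 - k of words of length k in the letters 0 and v with a v
  -- somewhere after a 0: these may follow level v but not climb v.
  excess : ℕ → ℕ
  excess zero    = 0
  excess (suc k) = k + 2 * excess k

  2^-excess : ∀ k → 2 ^ k ≡ suc (k + excess k)
  2^-excess zero    = refl
  2^-excess (suc k) = trans (cong (2 *_) (2^-excess k)) (expand k (excess k))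
    where
    expand : ∀ k g → 2 * suc (k + g) ≡ suc (suc k + (k + 2 * g))
    expand = solve-∀

  completions-level : ∀ k c r → completions k (suc c + r) (level (suc c)) ≡ ∑ballot k r + excess k
  completions-level zero    c r = refl
  completions-level (suc k) c r = begin
    completions (suc k) (suc c + r) (level (suc c))
      ≡⟨ sum-gap f c r (λ i i<c → completions-via-rejected k _ (δ-level-< (s<s i<c))) ⟩
    f 0 + (f (suc c + 0) + sum (applyUpTo (λ j → f (suc c + suc j)) r))
      ≡⟨ cong₂ _+_ drop (cong₂ _+_ stay rise) ⟩
    2 ^ k + (∑ballot k (suc r) + excess k + sum (applyDownFrom (∑ballot k ∘ suc) r))
      ≡⟨ cong (_+ (∑ballot k (suc r) + excess k + sum (applyDownFrom (∑ballot k ∘ suc) r)))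
              (2^-excess k) ⟩
    suc (k + excess k) + (∑ballot k (suc r) + excess k + sum (applyDownFrom (∑ballot k ∘ suc) r))
      ≡⟨ regroup k (excess k) (∑ballot k (suc r)) _ ⟩
    suc (sum (applyDownFrom (∑ballot k ∘ suc) (suc r))) + excess (suc k)
      ≡⟨ cong (_+ excess (suc k)) (∑ballot-step k r) ⟨
    ∑ballot (suc k) r + excess (suc k) ∎
    where
    f : ℕ → ℕ
    f a = completions k (suc (suc c + r)) (δ (level (suc c)) a)
    regroup : ∀ k g a s → suc (k + g) + (a + g + s) ≡ suc (a + s) + (k + 2 * g)
    regroup = solve-∀
    drop : f 0 ≡ 2 ^ k
    drop = subst (λ m → completions k m (mixed (suc c)) ≡ 2 ^ k) (+-suc (suc c) r)
             (completions-mixed k c (suc r))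
    stay : f (suc c + 0) ≡ ∑ballot k (suc r) + excess k
    stay = begin
      f (suc c + 0)                                       ≡⟨ cong f (+-identityʳ (suc c)) ⟩
      f (suc c)                                           ≡⟨ cong (completions k _) (δ-level-≡ c) ⟩
      completions k (suc (suc c + r)) (level (suc c))     ≡⟨ cong (λ m → completions k m (level (suc c))) (+-suc (suc c) r) ⟨
      completions k (suc c + suc r) (level (suc c))       ≡⟨ completions-level k c (suc r) ⟩
      ∑ballot k (suc r) + excess k                        ∎
    rise : sum (applyUpTo (λ j → f (suc c + suc j)) r) ≡ sum (applyDownFrom (∑ballot k ∘ suc) r)
    rise = trans
      (sum-applyUpTo-cong r (λ j → cong (completions k _)
        (trans (δ-level-> (m<m+n (suc c) z<s)) (cong climb (+-suc (suc c) j)))))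
      (sum-by-slack (λ m v → completions k m (climb v)) (∑ballot k) (completions-climb k) r (suc c))

  sum-applyDownFrom-+ : ∀ (f : ℕ → ℕ) d n →
    sum (applyDownFrom (λ i → f i + d) n) ≡ sum (applyDownFrom f n) + n * d
  sum-applyDownFrom-+ f d zero    = refl
  sum-applyDownFrom-+ f d (suc n) =
    trans (cong (f n + d +_) (sum-applyDownFrom-+ f d n)) (regroup (f n) d _ (n * d))
    where
    regroup : ∀ a d s t → a + d + (s + t) ≡ a + s + (d + t)
    regroup = solve-∀

  -- The case m = 0 is the counting formula, cleared of denominators and
  -- subtractions.  The induction needs every m, since appending a zero raises m.
  completions-zeros : ∀ k m →
    6 * completions k m zeros + (3 * m * (k * k + k + 2) + 6 + k ^ 3 + 11 * k)
      ≡ 6 * ∑ballot k m + 6 * suc m * 2 ^ k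
  completions-zeros zero    m = base m
    where
    base : ∀ m → 6 + (3 * m * 2 + 6 + 0 + 0) ≡ 6 + 6 * suc m * 1
    base = solve-∀
  completions-zeros (suc k) m = begin
    6 * completions (suc k) m zeros + (3 * m * (suc k * suc k + suc k + 2) + 6 + suc k ^ 3 + 11 * suc k)
      ≡⟨ cong (λ z → 6 * (Z + z) + (3 * m * (suc k * suc k + suc k + 2) + 6 + suc k ^ 3 + 11 * suc k)) rise ⟩
    6 * (Z + (S + m * G)) + (3 * m * (suc k * suc k + suc k + 2) + 6 + suc k ^ 3 + 11 * suc k)
      ≡⟨ left k m Z S G ⟩
    6 * Z + (3 * suc m * (k * k + k + 2) + 6 + k ^ 3 + 11 * k) + (6 * S + 6 * m * suc (k + G) + 6)
      ≡⟨ cong₂ _+_ (completions-zeros k (suc m)) (cong (λ p → 6 * S + 6 * m * p + 6) (sym (2^-excess k))) ⟩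
    6 * ∑ballot k (suc m) + 6 * (2 + m) * 2 ^ k + (6 * S + 6 * m * 2 ^ k + 6)
      ≡⟨ right m (∑ballot k (suc m)) S (2 ^ k) ⟩
    6 * suc (∑ballot k (suc m) + S) + 6 * suc m * (2 * 2 ^ k)
      ≡⟨ cong (λ d → 6 * d + 6 * suc m * 2 ^ suc k) (∑ballot-step k m) ⟨
    6 * ∑ballot (suc k) m + 6 * suc m * 2 ^ suc k ∎
    where
    Z = completions k (suc m) zeros
    S = sum (applyDownFrom (∑ballot k ∘ suc) m)
    G = excess k
    rise : sum (applyUpTo (λ j → completions k (suc m) (level (suc j))) m) ≡ S + m * G
    rise = trans (sum-by-slack (λ m v → completions k m (level v)) (λ r → ∑ballot k r + G)
                   (completions-level k) m 0)
                 (sum-applyDownFrom-+ (∑ballot k ∘ suc) G m)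
    left : ∀ k m Z S G →
      6 * (Z + (S + m * G)) + (3 * m * (suc k * suc k + suc k + 2) + 6 + suc k * (suc k * (suc k * 1)) + 11 * suc k)
        ≡ 6 * Z + (3 * suc m * (k * k + k + 2) + 6 + k * (k * (k * 1)) + 11 * k) + (6 * S + 6 * m * suc (k + G) + 6)
    left = solve-∀
    right : ∀ m D S P →
      6 * D + 6 * (2 + m) * P + (6 * S + 6 * m * P + 6) ≡ 6 * suc (D + S) + 6 * suc m * (2 * P)
    right = solve-∀

  -- Pattern avoidance is acceptance by the automaton

  singleton-⊆ : ∀ {m} (e : Vec ℕ m) i → (lookup e i ∷ []) ⊆ toList e
  singleton-⊆ (x ∷ e) zero    = refl ∷ minimum _
  singleton-⊆ (x ∷ e) (suc i) = x ∷ʳ singleton-⊆ e i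

  pair-⊆ : ∀ {m} (e : Vec ℕ m) {i j} → i Fin.< j → (lookup e i ∷ lookup e j ∷ []) ⊆ toList e
  pair-⊆ (x ∷ e) {zero}  {suc j} _   = refl ∷ singleton-⊆ e j
  pair-⊆ (x ∷ e) {suc i} {suc j} i<j = x ∷ʳ pair-⊆ e (s<s⁻¹ i<j)

  triple-⊆ : ∀ {m} (e : Vec ℕ m) {i j k} → i Fin.< j → j Fin.< k →
             (lookup e i ∷ lookup e j ∷ lookup e k ∷ []) ⊆ toList e
  triple-⊆ (x ∷ e) {zero}  {suc j} {suc k} _   j<k = refl ∷ pair-⊆ e (s<s⁻¹ j<k)
  triple-⊆ (x ∷ e) {suc i} {suc j} {suc k} i<j j<k = x ∷ʳ triple-⊆ e (s<s⁻¹ i<j) (s<s⁻¹ j<k)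

  singleton-positions : ∀ {m} (e : Vec ℕ m) {u} → (u ∷ []) ⊆ toList e → ∃ λ i → lookup e i ≡ u
  singleton-positions (x ∷ e) (_ ∷ʳ p)   = let i , eq = singleton-positions e p in suc i , eq
  singleton-positions (x ∷ e) (refl ∷ _) = zero , refl

  pair-positions : ∀ {m} (e : Vec ℕ m) {u v} → (u ∷ v ∷ []) ⊆ toList e →
                   ∃₂ λ i j → i Fin.< j × lookup e i ≡ u × lookup e j ≡ v
  pair-positions (x ∷ e) (_ ∷ʳ p) =
    let i , j , i<j , eqs = pair-positions e p in suc i , suc j , s<s i<j , eqs
  pair-positions (x ∷ e) (refl ∷ p) =
    let j , eq = singleton-positions e p in zero , suc j , z<s , refl , eq

  triple-positions : ∀ {m} (e : Vec ℕ m) {u v w} → (u ∷ v ∷ w ∷ []) ⊆ toList e →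
                     ∃₂ λ i j → ∃ λ k → i Fin.< j × j Fin.< k ×
                       lookup e i ≡ u × lookup e j ≡ v × lookup e k ≡ w
  triple-positions (x ∷ e) (_ ∷ʳ p) =
    let i , j , k , i<j , j<k , eqs = triple-positions e p
    in suc i , suc j , suc k , s<s i<j , s<s j<k , eqs
  triple-positions (x ∷ e) (refl ∷ p) =
    let j , k , j<k , eqs = pair-positions e p in zero , suc j , suc k , z<s , s<s j<k , refl , eqs

  increasing-triple : ∀ {m} {i j k : Fin m} → i Fin.< j → j Fin.< k →
                      StrictlyIncreasing (i ∷ j ∷ k ∷ [])
  increasing-triple i<j j<k zero             (suc zero)       _ = i<j
  increasing-triple i<j j<k zero             (suc (suc zero)) _ = <-trans i<j j<k
  increasing-triple i<j j<k (suc zero)       (suc (suc zero)) _ = j<k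
  increasing-triple i<j j<k (suc zero)       (suc zero)       (s<s ())
  increasing-triple i<j j<k (suc (suc zero)) (suc zero)       (s<s ())
  increasing-triple i<j j<k (suc (suc zero)) (suc (suc zero)) (s<s (s<s ()))

  monotone⇒orderIsomorphic : ∀ {k} {u v : Fin k → ℕ} → (∀ i j → v i < v j → u i < u j) →
                             (∀ i j → v i ≡ v j → u i ≡ u j) → OrderIsomorphic u v
  monotone⇒orderIsomorphic {u = u} {v} mono cong′ i j = mk⇔ reflect (mono i j) , mk⇔ reflect≡ (cong′ i j)
    where
    reflect : u i < u j → v i < v j
    reflect ui<uj with <-cmp (v i) (v j)
    ... | tri< vi<vj _ _ = vi<vj
    ... | tri≈ _ vi≡vj _ = contradiction (cong′ i j vi≡vj) (<⇒≢ ui<uj)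
    ... | tri> _ _ vj<vi = contradiction (mono j i vj<vi) (<-asym ui<uj)
    reflect≡ : u i ≡ u j → v i ≡ v j
    reflect≡ ui≡uj with <-cmp (v i) (v j)
    ... | tri< vi<vj _ _ = contradiction ui≡uj (<⇒≢ (mono i j vi<vj))
    ... | tri≈ _ vi≡vj _ = vi≡vj
    ... | tri> _ _ vj<vi = contradiction ui≡uj (>⇒≢ (mono j i vj<vi))

  -- The letters 0, 1, 2 of a pattern replaced by a, b, c; the last clause is meant
  -- for 2 only.
  relabel : (a b c : ℕ) → ℕ → ℕ
  relabel a b c 0 = a
  relabel a b c 1 = b
  relabel a b c _ = c

  relabel-mono : ∀ {a b c} → a < b → b < c → ∀ {x y} → y ≤ 2 → x < y → relabel a b c x < relabel a b c y
  relabel-mono a<b b<c {0} {1} _ _ = a<b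
  relabel-mono a<b b<c {0} {2} _ _ = <-trans a<b b<c
  relabel-mono a<b b<c {1} {1} _ (s<s ())
  relabel-mono a<b b<c {1} {2} _ _ = b<c
  relabel-mono a<b b<c {suc (suc x)} {1} _ (s<s ())
  relabel-mono a<b b<c {suc (suc x)} {2} _ (s<s (s<s ()))
  relabel-mono a<b b<c {_} {suc (suc (suc y))} (s≤s (s≤s ())) _

  relabel⇒orderIsomorphic : ∀ {a b c k} {u v : Fin k → ℕ} → a < b → b < c → (∀ i → v i ≤ 2) →
                            (∀ i → u i ≡ relabel a b c (v i)) → OrderIsomorphic u v
  relabel⇒orderIsomorphic {a} {b} {c} a<b b<c v≤2 u≡ = monotone⇒orderIsomorphic
    (λ i j vi<vj → subst₂ _<_ (sym (u≡ i)) (sym (u≡ j)) (relabel-mono a<b b<c (v≤2 j) vi<vj))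
    (λ i j vi≡vj → trans (u≡ i) (trans (cong (relabel a b c) vi≡vj) (sym (u≡ j))))

  -- The letters of e, last one first: appending a letter to e is then consing it
  -- onto the word.  Patterns below are accordingly written backwards.
  word : ∀ {m} → Vec ℕ m → List ℕ
  word e = reverse (toList e)

  word-∷ʳ : ∀ {m} (e : Vec ℕ m) a → word (e Vec.∷ʳ a) ≡ a ∷ word e
  word-∷ʳ e a = trans (cong reverse (toList-∷ʳ a e)) (reverse-++ (toList e) (a ∷ []))

  length-word : ∀ {m} (e : Vec ℕ m) → length (word e) ≡ m
  length-word e = trans (length-reverse (toList e)) (length-toList e)

  -- Avoidance of 102 and of 021 by a reversed word: the sublists c a b and b c a
  -- are the occurrences b a c and a c b read from the right.
  No102 No021 Good : List ℕ → Set
  No102 w = ∀ {a b c} → a < b → b < c → ¬ ((c ∷ a ∷ b ∷ []) ⊆ w)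
  No021 w = ∀ {a b c} → a < b → b < c → ¬ ((b ∷ c ∷ a ∷ []) ⊆ w)
  Good w  = No102 w × No021 w

  avoids-102 : ∀ {m} (e : Vec ℕ m) → Avoids (1 ∷ 0 ∷ 2 ∷ []) e ⇔ No102 (word e)
  avoids-102 e = mk⇔ to from
    where
    to : Avoids (1 ∷ 0 ∷ 2 ∷ []) e → No102 (word e)
    to avoids {a} {b} {c} a<b b<c p
      with i , j , k , i<j , j<k , refl , refl , refl ←
        triple-positions e (reverse⁻ {as = b ∷ a ∷ c ∷ []} p) =
      avoids (i ∷ j ∷ k ∷ [] , increasing-triple i<j j<k , relabel⇒orderIsomorphic a<b b<c
        (λ { zero → s≤s z≤n ; (suc zero) → z≤n ; (suc (suc zero)) → ≤-refl })
        (λ { zero → refl ; (suc zero) → refl ; (suc (suc zero)) → refl }))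
    from : No102 (word e) → Avoids (1 ∷ 0 ∷ 2 ∷ []) e
    from avoids (i ∷ j ∷ k ∷ [] , inc , iso) =
      avoids (Equivalence.from (proj₁ (iso (suc zero) zero)) z<s)
             (Equivalence.from (proj₁ (iso zero (suc (suc zero)))) (s<s z<s))
             (reverse⁺ (triple-⊆ e (inc zero (suc zero) z<s) (inc (suc zero) (suc (suc zero)) (s<s z<s))))

  avoids-021 : ∀ {m} (e : Vec ℕ m) → Avoids (0 ∷ 2 ∷ 1 ∷ []) e ⇔ No021 (word e)
  avoids-021 e = mk⇔ to from
    where
    to : Avoids (0 ∷ 2 ∷ 1 ∷ []) e → No021 (word e)
    to avoids {a} {b} {c} a<b b<c p
      with i , j , k , i<j , j<k , refl , refl , refl ←
        triple-positions e (reverse⁻ {as = a ∷ c ∷ b ∷ []} p) =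
      avoids (i ∷ j ∷ k ∷ [] , increasing-triple i<j j<k , relabel⇒orderIsomorphic a<b b<c
        (λ { zero → z≤n ; (suc zero) → ≤-refl ; (suc (suc zero)) → s≤s z≤n })
        (λ { zero → refl ; (suc zero) → refl ; (suc (suc zero)) → refl }))
    from : No021 (word e) → Avoids (0 ∷ 2 ∷ 1 ∷ []) e
    from avoids (i ∷ j ∷ k ∷ [] , inc , iso) =
      avoids (Equivalence.from (proj₁ (iso zero (suc (suc zero)))) z<s)
             (Equivalence.from (proj₁ (iso (suc (suc zero)) (suc zero))) (s<s z<s))
             (reverse⁺ (triple-⊆ e (inc zero (suc zero) z<s) (inc (suc zero) (suc (suc zero)) (s<s z<s))))

  avoidsAll⇔good : ∀ {m} (e : Vec ℕ m) → AvoidsAll patterns e ⇔ Good (word e)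
  avoidsAll⇔good e = mk⇔
    (λ { (p ∷ q ∷ []) → Equivalence.to (avoids-102 e) p , Equivalence.to (avoids-021 e) q })
    (λ { (p , q) → Equivalence.from (avoids-102 e) p ∷ Equivalence.from (avoids-021 e) q ∷ [] })

  good-tail : ∀ {x w} → Good (x ∷ w) → Good w
  good-tail (no102 , no021) = (λ a<b b<c p → no102 a<b b<c (_ ∷ʳ p)) , (λ a<b b<c p → no021 a<b b<c (_ ∷ʳ p))

  -- A new last letter x can only play the last letter of a pattern.
  good-∷ : ∀ {x w} → Good w →
           (∀ {a b} → a < b → b < x → ¬ ((a ∷ b ∷ []) ⊆ w)) →
           (∀ {a c} → a < x → x < c → ¬ ((c ∷ a ∷ []) ⊆ w)) → Good (x ∷ w)
  good-∷ (no102 , no021) new102 new021 =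
    (λ { a<b b<c (_ ∷ʳ p) → no102 a<b b<c p ; a<b b<c (refl ∷ p) → new102 a<b b<c p }) ,
    (λ { a<b b<c (_ ∷ʳ p) → no021 a<b b<c p ; a<b b<c (refl ∷ p) → new021 a<b b<c p })

  good-0∷ : ∀ {w} → Good w → Good (0 ∷ w)
  good-0∷ good = good-∷ good (λ _ ()) (λ ())

  -- Weakly increasing, for a reversed word.
  Rising : List ℕ → Set
  Rising w = ∀ {x y} → (x ∷ y ∷ []) ⊆ w → y ≤ x

  first-∈ : ∀ {x y : ℕ} {w} → (x ∷ y ∷ []) ⊆ w → x ∈ w
  first-∈ p = lookup-⊆ p (here refl)

  second-∈ : ∀ {x y : ℕ} {w} → (x ∷ y ∷ []) ⊆ w → y ∈ w
  second-∈ p = lookup-⊆ p (there (here refl))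

  rising-∷ : ∀ {x w} → All (_≤ x) w → Rising w → Rising (x ∷ w)
  rising-∷ w≤x rising (_ ∷ʳ p)   = rising p
  rising-∷ w≤x rising (refl ∷ p) = All.lookup w≤x (to∈ p)

  good-max∷ : ∀ {x w} → All (_≤ x) w → Rising w → Good w → Good (x ∷ w)
  good-max∷ w≤x rising good = good-∷ good
    (λ a<b _ p → contradiction a<b (≤⇒≯ (rising p)))
    (λ _ x<c p → contradiction x<c (≤⇒≯ (All.lookup w≤x (first-∈ p))))

  021-∷ : ∀ {x v w} → 0 < x → x < v → (v ∷ 0 ∷ []) ⊆ w → ¬ Good (x ∷ w)
  021-∷ 0<x x<v p (_ , no021) = no021 0<x x<v (refl ∷ p)

  102-∷ : ∀ {x b w} → 0 < b → b < x → (0 ∷ b ∷ []) ⊆ w → ¬ Good (x ∷ w)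
  102-∷ 0<b b<x p (no102 , _) = no102 0<b b<x (refl ∷ p)

  -- The state after all letters; the recursion consumes the list from its far end,
  -- that is, in the order of the sequence.
  state : List ℕ → State
  state []      = zeros
  state (a ∷ w) = δ (state w) a

  -- What is known of a reversed word in each state.  Besides the range of the
  -- letters, it records the sublists that complete a pattern when a wrong letter
  -- follows: v 0 (a 0 before a v) for 021, and 0 b (a b before a 0) for 102.  The
  -- clause for rejected is a filler, as Describes does not use it.
  Shape : State → List ℕ → Set
  Shape zeros     w = All (_≡ 0) w
  Shape (level v) w = 0 < v × All (λ x → x ≡ 0 ⊎ x ≡ v) w × Rising w × (v ∷ 0 ∷ []) ⊆ w
  Shape (climb v) w = All (_≤ v) w × Rising w × (v ∷ 0 ∷ []) ⊆ w × ∃ λ b → 0 < b × b < v × b ∈ w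
  Shape (mixed v) w = 0 < v × All (λ x → x ≡ 0 ⊎ x ≡ v) w × (v ∷ 0 ∷ []) ⊆ w × (0 ∷ v ∷ []) ⊆ w
  Shape closing   w = ∃₂ λ b v → b < v × 0 < b × (v ∷ 0 ∷ []) ⊆ w × (0 ∷ b ∷ []) ⊆ w
  Shape rejected  w = ⊥

  -- The invariant of the automaton: the rejected words are exactly those that
  -- contain a pattern, and the others have the shape of their state.
  Describes : State → List ℕ → Set
  Describes rejected w = ¬ Good w
  Describes σ        w = Good w × Shape σ w

  two-values-≤ : ∀ {v w} → All (λ x → x ≡ 0 ⊎ x ≡ v) w → All (_≤ v) w
  two-values-≤ = All.map λ { (inj₁ refl) → z≤n ; (inj₂ refl) → ≤-refl }

  describes-climb : ∀ {x v w} → 0 < v → v < x → All (_≤ v) w → Rising w → (v ∷ 0 ∷ []) ⊆ w → Good w →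
                    Describes (climb x) (x ∷ w)
  describes-climb {x} {v} 0<v v<x w≤v rising v0 good =
    good-max∷ w≤x rising good ,
    ≤-refl ∷ w≤x , rising-∷ w≤x rising , refl ∷ from∈ (second-∈ v0) ,
    v , 0<v , v<x , there (first-∈ v0)
    where
    w≤x = All.map (λ y≤v → ≤-trans y≤v (<⇒≤ v<x)) w≤v

  -- The bound on a is that of an inversion sequence.  It matters only for the empty
  -- word: the first letter must be 0, so that later a 0 precedes every positive
  -- letter.
  describes-∷ : ∀ σ {w} a → a ≤ length w → Describes σ w → Describes (δ σ a) (a ∷ w)
  describes-∷ zeros zero _ (good , all0) = good-0∷ good , refl ∷ all0
  describes-∷ zeros {[]} (suc a) () _
  describes-∷ zeros {w@(_ ∷ _)} (suc a) _ (good , all0@(refl ∷ _)) =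
    good-max∷ w≤a rising good ,
    z<s , inj₂ refl ∷ All.map inj₁ all0 , rising-∷ w≤a rising , refl ∷ from∈ (here refl)
    where
    w≤a : All (_≤ suc a) w
    w≤a = All.map (λ { refl → z≤n }) all0
    rising : Rising w
    rising p with refl ← All.lookup all0 (second-∈ p) = z≤n
  describes-∷ (level v) zero _ (good , 0<v , vals , rising , v0) =
    good-0∷ good , 0<v , inj₁ refl ∷ vals , 0 ∷ʳ v0 , refl ∷ from∈ (first-∈ v0)
  describes-∷ (level v) (suc a) _ (good , 0<v , vals , rising , v0) with <-cmp (suc a) v
  ... | tri< a<v _ _  = 021-∷ z<s a<v v0
  ... | tri≈ _ refl _ =
    good-max∷ (two-values-≤ vals) rising good ,
    0<v , inj₂ refl ∷ vals , rising-∷ (two-values-≤ vals) rising , _ ∷ʳ v0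
  ... | tri> _ _ v<a  = describes-climb 0<v v<a (two-values-≤ vals) rising v0 good
  describes-∷ (climb v) zero _ (good , w≤v , rising , v0 , b , 0<b , b<v , b∈w) =
    good-0∷ good , b , v , b<v , 0<b , 0 ∷ʳ v0 , refl ∷ from∈ b∈w
  describes-∷ (climb v) (suc a) _ (good , w≤v , rising , v0 , b , 0<b , b<v , b∈w) with <-cmp (suc a) v
  ... | tri< a<v _ _  = 021-∷ z<s a<v v0
  ... | tri≈ _ refl _ =
    good-max∷ w≤v rising good ,
    ≤-refl ∷ w≤v , rising-∷ w≤v rising , _ ∷ʳ v0 , b , 0<b , b<v , there b∈w
  ... | tri> _ _ v<a  = describes-climb (<-trans 0<b b<v) v<a w≤v rising v0 good
  describes-∷ (mixed v) zero _ (good , 0<v , vals , v0 , 0v) =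
    good-0∷ good , 0<v , inj₁ refl ∷ vals , 0 ∷ʳ v0 , 0 ∷ʳ 0v
  describes-∷ (mixed v) (suc a) _ (good , 0<v , vals , v0 , 0v) with <-cmp (suc a) v
  ... | tri< a<v _ _  = 021-∷ z<s a<v v0
  ... | tri> _ _ v<a  = 102-∷ 0<v v<a 0v
  ... | tri≈ _ refl _ =
    good-∷ good
      (λ a<b b<v p → [ (λ { refl → contradiction a<b (λ ()) }) , (λ { refl → <-irrefl refl b<v }) ]′
                       (All.lookup vals (second-∈ p)))
      (λ _ v<c p → contradiction v<c (≤⇒≯ (All.lookup (two-values-≤ vals) (first-∈ p)))) ,
    0<v , inj₂ refl ∷ vals , _ ∷ʳ v0 , _ ∷ʳ 0v
  describes-∷ closing zero _ (good , b , v , b<v , 0<b , v0 , 0b) =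
    good-0∷ good , b , v , b<v , 0<b , 0 ∷ʳ v0 , 0 ∷ʳ 0b
  describes-∷ closing (suc a) _ (good , b , v , b<v , 0<b , v0 , 0b) with suc a ≤? b
  ... | yes a≤b = 021-∷ z<s (≤-<-trans a≤b b<v) v0
  ... | no  a≰b = 102-∷ 0<b (≰⇒> a≰b) 0b
  describes-∷ rejected a _ bad = bad ∘ good-tail

  describes-state : ∀ {m} {e : Vec ℕ m} → e ∈ inversionSequences m → Describes (state (word e)) (word e)
  describes-state {zero} (here refl) = ((λ _ _ ()) , (λ _ _ ())) , []
  describes-state {suc m} e∈
    with e , a , e∈ , a∈ , refl ← ∈-cartesianProductWith⁻ Vec._∷ʳ_ (inversionSequences m) (upTo (suc m)) e∈
    rewrite word-∷ʳ e a =
    describes-∷ (state (word e)) a (subst (a ≤_) (sym (length-word e)) (s≤s⁻¹ (∈-upTo⁻ a∈))) (describes-state e∈)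

  accept-good : ∀ {σ w} → Describes σ w → Good w → accept σ ≡ 1
  accept-good {zeros}    _   _ = refl
  accept-good {level _}  _   _ = refl
  accept-good {climb _}  _   _ = refl
  accept-good {mixed _}  _   _ = refl
  accept-good {closing}  _   _ = refl
  accept-good {rejected} bad g = contradiction g bad

  accept-bad : ∀ {σ w} → Describes σ w → ¬ Good w → accept σ ≡ 0
  accept-bad {zeros}    d bad = contradiction (proj₁ d) bad
  accept-bad {level _}  d bad = contradiction (proj₁ d) bad
  accept-bad {climb _}  d bad = contradiction (proj₁ d) bad
  accept-bad {mixed _}  d bad = contradiction (proj₁ d) bad
  accept-bad {closing}  d bad = contradiction (proj₁ d) bad
  accept-bad {rejected} d bad = refl

  length-filter-sum : ∀ {A : Set} {P : A → Set} (P? : Decidable P) (f : A → ℕ) (xs : List A) →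
    (∀ {x} → x ∈ xs → (P x → f x ≡ 1) × (¬ P x → f x ≡ 0)) →
    length (filter P? xs) ≡ sum (map f xs)
  length-filter-sum P? f []       f≡ = refl
  length-filter-sum P? f (x ∷ xs) f≡ with P? x
  ... | yes Px = cong₂ _+_ (sym (proj₁ (f≡ (here refl)) Px)) (length-filter-sum P? f xs (f≡ ∘ there))
  ... | no ¬Px = cong₂ _+_ (sym (proj₂ (f≡ (here refl)) ¬Px)) (length-filter-sum P? f xs (f≡ ∘ there))

  sum-cartesianProductWith : ∀ {A B C : Set} (g : C → ℕ) (f : A → B → C) xs ys →
    sum (map g (cartesianProductWith f xs ys)) ≡ sum (map (λ x → sum (map (λ y → g (f x y)) ys)) xs)
  sum-cartesianProductWith g f []       ys = refl
  sum-cartesianProductWith g f (x ∷ xs) ys = begin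
    sum (map g (map (f x) ys ++ cartesianProductWith f xs ys))
      ≡⟨ cong sum (map-++ g (map (f x) ys) _) ⟩
    sum (map g (map (f x) ys) ++ map g (cartesianProductWith f xs ys))
      ≡⟨ sum-++ (map g (map (f x) ys)) _ ⟩
    sum (map g (map (f x) ys)) + sum (map g (cartesianProductWith f xs ys))
      ≡⟨ cong₂ _+_ (cong sum (sym (map-∘ ys))) (sum-cartesianProductWith g f xs ys) ⟩
    sum (map (λ x → sum (map (λ y → g (f x y)) ys)) (x ∷ xs)) ∎

  -- The m letters already chosen are summed over, the k remaining ones are counted
  -- by completions.
  sum-completions : ∀ m k →
    sum (map (λ e → completions k m (state (word e))) (inversionSequences m)) ≡ completions (m + k) 0 zeros
  sum-completions zero    k = +-identityʳ (completions k 0 zeros)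
  sum-completions (suc m) k = begin
    sum (map (λ e → completions k (suc m) (state (word e))) (inversionSequences (suc m)))
      ≡⟨ sum-cartesianProductWith _ Vec._∷ʳ_ (inversionSequences m) (upTo (suc m)) ⟩
    sum (map (λ e → sum (map (λ a → completions k (suc m) (state (word (e Vec.∷ʳ a)))) (upTo (suc m))))
             (inversionSequences m))
      ≡⟨ cong sum (map-cong extend (inversionSequences m)) ⟩
    sum (map (λ e → completions (suc k) m (state (word e))) (inversionSequences m))
      ≡⟨ sum-completions m (suc k) ⟩
    completions (m + suc k) 0 zeros
      ≡⟨ cong (λ n → completions n 0 zeros) (+-suc m k) ⟩
    completions (suc m + k) 0 zeros ∎
    where
    extend : ∀ e → sum (map (λ a → completions k (suc m) (state (word (e Vec.∷ʳ a)))) (upTo (suc m)))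
                   ≡ completions (suc k) m (state (word e))
    extend e = trans
      (cong sum (map-upTo (λ a → completions k (suc m) (state (word (e Vec.∷ʳ a)))) (suc m)))
      (sum-applyUpTo-cong (suc m) (λ a → cong (λ w → completions k (suc m) (state w)) (word-∷ʳ e a)))

  ∣I∣-completions : ∀ n → ∣I∣ n patterns ≡ completions (suc n) 0 zeros
  ∣I∣-completions n = begin
    ∣I∣ n patterns
      ≡⟨ length-filter-sum (avoidsAll? patterns) (λ e → accept (state (word e))) (inversionSequences (suc n))
           (λ {e} e∈ → (λ av → accept-good (describes-state e∈) (Equivalence.to (avoidsAll⇔good e) av)) ,
                   (λ ¬av → accept-bad (describes-state e∈) (¬av ∘ Equivalence.from (avoidsAll⇔good e)))) ⟩
    sum (map (λ e → completions 0 (suc n) (state (word e))) (inversionSequences (suc n)))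
      ≡⟨ sum-completions (suc n) 0 ⟩
    completions (suc n + 0) 0 zeros
      ≡⟨ cong (λ n → completions n 0 zeros) (+-identityʳ (suc n)) ⟩
    completions (suc n) 0 zeros ∎

open Counting using (ballot; catalan; suc-*-catalan; ∑ballot; zeros; completions; completions-zeros; ∣I∣-completions)

open import Data.Nat.Base using (zero; s≤s; z≤n)
import Data.Nat.Properties as ℕ
open import Data.Integer.Base as ℤ using (+_)
import Data.Integer.Properties as ℤ
open import Data.Rational.Base using (ℚ; 0ℚ; 1ℚ; _+_; _*_; _-_; -_; _/_; fromℚᵘ)
open import Data.Rational.Properties as ℚ
  using (fromℚᵘ-toℚᵘ; toℚᵘ-fromℚᵘ; toℚᵘ-homo-+; toℚᵘ-homo-*; fromℚᵘ-cong;
         +-assoc; *-comm; *-identityˡ; *-zeroˡ; *-zeroʳ)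
open import Data.Rational.Solver using (module +-*-Solver)
open import Data.Rational.Unnormalised.Base as ℚᵘ using (mkℚᵘ; *≡*)
import Data.Rational.Unnormalised.Properties as ℚᵘ
open +-*-Solver using (solve; Polynomial; _:=_; _:+_; _:*_; _:-_; :-_; con)

-- The counting formula over the rationals

fromℚᵘ-homo-+ : ∀ p q → fromℚᵘ (p ℚᵘ.+ q) ≡ fromℚᵘ p + fromℚᵘ q
fromℚᵘ-homo-+ p q = sym (trans (sym (fromℚᵘ-toℚᵘ (fromℚᵘ p + fromℚᵘ q))) (fromℚᵘ-cong
  (ℚᵘ.≃-trans (toℚᵘ-homo-+ (fromℚᵘ p) (fromℚᵘ q)) (ℚᵘ.+-cong (toℚᵘ-fromℚᵘ p) (toℚᵘ-fromℚᵘ q)))))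

fromℚᵘ-homo-* : ∀ p q → fromℚᵘ (p ℚᵘ.* q) ≡ fromℚᵘ p * fromℚᵘ q
fromℚᵘ-homo-* p q = sym (trans (sym (fromℚᵘ-toℚᵘ (fromℚᵘ p * fromℚᵘ q))) (fromℚᵘ-cong
  (ℚᵘ.≃-trans (toℚᵘ-homo-* (fromℚᵘ p) (fromℚᵘ q)) (ℚᵘ.*-cong (toℚᵘ-fromℚᵘ p) (toℚᵘ-fromℚᵘ q)))))

fromℕℚ-+ : ∀ m n → fromℕℚ (m ℕ.+ n) ≡ fromℕℚ m + fromℕℚ n
fromℕℚ-+ m n = trans
  (fromℚᵘ-cong {mkℚᵘ (+ (m ℕ.+ n)) 0} {mkℚᵘ (+ m) 0 ℚᵘ.+ mkℚᵘ (+ n) 0}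
    (*≡* (cong₂ (λ a b → (a ℤ.+ b) ℤ.* + 1) (sym (ℤ.*-identityʳ (+ m))) (sym (ℤ.*-identityʳ (+ n))))))
  (fromℚᵘ-homo-+ (mkℚᵘ (+ m) 0) (mkℚᵘ (+ n) 0))

fromℕℚ-* : ∀ m n → fromℕℚ (m ℕ.* n) ≡ fromℕℚ m * fromℕℚ n
fromℕℚ-* m n = trans
  (fromℚᵘ-cong {mkℚᵘ (+ (m ℕ.* n)) 0} {mkℚᵘ (+ m) 0 ℚᵘ.* mkℚᵘ (+ n) 0}
    (*≡* (cong (ℤ._* + 1) (ℤ.pos-* m n))))
  (fromℚᵘ-homo-* (mkℚᵘ (+ m) 0) (mkℚᵘ (+ n) 0))

1/suc-* : ∀ k n → (+ 1 / suc k) * fromℕℚ (suc k ℕ.* n) ≡ fromℕℚ n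
1/suc-* k n = begin
  (+ 1 / suc k) * fromℕℚ (suc k ℕ.* n)
    ≡⟨ fromℚᵘ-homo-* (mkℚᵘ (+ 1) k) (mkℚᵘ (+ (suc k ℕ.* n)) 0) ⟨
  fromℚᵘ (mkℚᵘ (+ 1) k ℚᵘ.* mkℚᵘ (+ (suc k ℕ.* n)) 0)
    ≡⟨ fromℚᵘ-cong {mkℚᵘ (+ 1) k ℚᵘ.* mkℚᵘ (+ (suc k ℕ.* n)) 0} {mkℚᵘ (+ n) 0} (*≡* cross) ⟩
  fromℕℚ n ∎
  where
  cross : + 1 ℤ.* + (suc k ℕ.* n) ℤ.* + 1 ≡ + n ℤ.* + (suc k ℕ.* 1)
  cross = begin
    + 1 ℤ.* + (suc k ℕ.* n) ℤ.* + 1  ≡⟨ ℤ.*-identityʳ (+ 1 ℤ.* + (suc k ℕ.* n)) ⟩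
    + 1 ℤ.* + (suc k ℕ.* n)          ≡⟨ ℤ.*-identityˡ (+ (suc k ℕ.* n)) ⟩
    + (suc k ℕ.* n)                  ≡⟨ cong +_ (ℕ.*-comm (suc k) n) ⟩
    + (n ℕ.* suc k)                  ≡⟨ cong (λ m → + (n ℕ.* m)) (ℕ.*-identityʳ (suc k)) ⟨
    + (n ℕ.* (suc k ℕ.* 1))          ≡⟨ ℤ.pos-* n (suc k ℕ.* 1) ⟩
    + n ℤ.* + (suc k ℕ.* 1)          ∎

-- The summand of the theorem.
catalanTerm : ℕ → ℚ
catalanTerm k = (+ 1 / suc k) * fromℕℚ ((2 ℕ.* k) C k)

catalanTerm-catalan : ∀ k → catalanTerm k ≡ fromℕℚ (catalan k)
catalanTerm-catalan k = begin
  (+ 1 / suc k) * fromℕℚ ((2 ℕ.* k) C k)          ≡⟨ cong (λ m → (+ 1 / suc k) * fromℕℚ m) (suc-*-catalan k) ⟨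
  (+ 1 / suc k) * fromℕℚ (suc k ℕ.* catalan k)    ≡⟨ 1/suc-* k (catalan k) ⟩
  fromℕℚ (catalan k)                              ∎

∑-last : ∀ (f : ℕ → ℚ) n → ∑ {suc n} (λ k → f (toℕ k)) ≡ ∑ {n} (λ k → f (toℕ k)) + f n
∑-last f zero    = ℚ.+-comm (f 0) 0ℚ
∑-last f (suc n) = trans (cong (λ s → f 0 + s) (∑-last (f ∘ suc) n))
                         (sym (+-assoc (f 0) (∑ {n} (λ k → f (suc (toℕ k)))) (f (suc n))))

-- The partial sums of the Catalan numbers, which are also the coefficients of
-- the first summand (1 - s) / (2x(1 - x)) of the generating function.
partialSums : PowerSeries
partialSums n = ∑ {suc n} (λ k → catalanTerm (toℕ k))

partialSums-∑ballot : ∀ n → partialSums n ≡ fromℕℚ (∑ballot n 0)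
partialSums-∑ballot zero    = refl
partialSums-∑ballot (suc n) = begin
  partialSums (suc n)                                 ≡⟨ ∑-last catalanTerm (suc n) ⟩
  partialSums n + catalanTerm (suc n)                 ≡⟨ cong₂ _+_ (partialSums-∑ballot n) (catalanTerm-catalan (suc n)) ⟩
  fromℕℚ (∑ballot n 0) + fromℕℚ (catalan (suc n))     ≡⟨ fromℕℚ-+ (∑ballot n 0) (catalan (suc n)) ⟨
  fromℕℚ (∑ballot (suc n) 0)                          ∎

counting-formula : ∀ n → 1 ≤ n →
  fromℕℚ (∣I∣ (pred n) patterns)
    ≡ partialSums n - 1ℚ - (+ 1 / 6) * fromℕℚ (n ℕ.^ 3) - (+ 11 / 6) * fromℕℚ n + fromℕℚ (2 ℕ.^ n)
counting-formula n@(suc k) _ = begin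
  I
    ≡⟨ solve 3 (λ i c ν → i := con (+ 1 / 6) :* (con (+ 6 / 1) :* i :+ (con (+ 6 / 1) :+ c :+ con (+ 11 / 1) :* ν))
                 :- con (+ 1 / 6) :* (con (+ 6 / 1) :+ c :+ con (+ 11 / 1) :* ν)) refl I c ν ⟩
  (+ 1 / 6) * (fromℕℚ 6 * I + X) - (+ 1 / 6) * X
    ≡⟨ cong (λ z → (+ 1 / 6) * z - (+ 1 / 6) * X) scaled ⟩
  (+ 1 / 6) * (fromℕℚ 6 * D + fromℕℚ 6 * t) - (+ 1 / 6) * X
    ≡⟨ solve 4 (λ d t c ν → con (+ 1 / 6) :* (con (+ 6 / 1) :* d :+ con (+ 6 / 1) :* t)
                 :- con (+ 1 / 6) :* (con (+ 6 / 1) :+ c :+ con (+ 11 / 1) :* ν)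
                 := d :- con 1ℚ :- con (+ 1 / 6) :* c :- con (+ 11 / 6) :* ν :+ t) refl D t c ν ⟩
  D - 1ℚ - (+ 1 / 6) * c - (+ 11 / 6) * ν + t
    ≡⟨ cong (λ d → d - 1ℚ - (+ 1 / 6) * c - (+ 11 / 6) * ν + t) (partialSums-∑ballot n) ⟨
  partialSums n - 1ℚ - (+ 1 / 6) * c - (+ 11 / 6) * ν + t ∎
  where
  I = fromℕℚ (∣I∣ k patterns)
  D = fromℕℚ (∑ballot n 0)
  t = fromℕℚ (2 ℕ.^ n)
  c = fromℕℚ (n ℕ.^ 3)
  ν = fromℕℚ n
  X = fromℕℚ 6 + c + fromℕℚ 11 * ν
  Z = completions n 0 zeros
  scaled : fromℕℚ 6 * I + X ≡ fromℕℚ 6 * D + fromℕℚ 6 * t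
  scaled = begin
    fromℕℚ 6 * I + X
      ≡⟨ cong (λ i → fromℕℚ 6 * fromℕℚ i + X) (∣I∣-completions k) ⟩
    fromℕℚ 6 * fromℕℚ Z + (fromℕℚ 6 + c + fromℕℚ 11 * ν)
      ≡⟨ cong₂ _+_ (fromℕℚ-* 6 Z)
           (trans (fromℕℚ-+ (6 ℕ.+ n ℕ.^ 3) (11 ℕ.* n))
                  (cong₂ _+_ (fromℕℚ-+ 6 (n ℕ.^ 3)) (fromℕℚ-* 11 n))) ⟨
    fromℕℚ (6 ℕ.* Z) + fromℕℚ (6 ℕ.+ n ℕ.^ 3 ℕ.+ 11 ℕ.* n)
      ≡⟨ fromℕℚ-+ (6 ℕ.* Z) (6 ℕ.+ n ℕ.^ 3 ℕ.+ 11 ℕ.* n) ⟨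
    fromℕℚ (6 ℕ.* Z ℕ.+ (6 ℕ.+ n ℕ.^ 3 ℕ.+ 11 ℕ.* n))
      ≡⟨ cong fromℕℚ (completions-zeros n 0) ⟩
    fromℕℚ (6 ℕ.* ∑ballot n 0 ℕ.+ 6 ℕ.* 2 ℕ.^ n)
      ≡⟨ fromℕℚ-+ (6 ℕ.* ∑ballot n 0) (6 ℕ.* 2 ℕ.^ n) ⟩
    fromℕℚ (6 ℕ.* ∑ballot n 0) + fromℕℚ (6 ℕ.* 2 ℕ.^ n)
      ≡⟨ cong₂ _+_ (fromℕℚ-* 6 (∑ballot n 0)) (fromℕℚ-* 6 (2 ℕ.^ n)) ⟩
    fromℕℚ 6 * D + fromℕℚ 6 * t ∎

-- Products of power series

-- The shifted series (f - f 0) / x.  By the definition of the Cauchy product,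
-- (f *ₛ g) (suc n) is f 0 * g (suc n) + (tail f *ₛ g) n; the inductions below
-- rest on this.
tail : PowerSeries → PowerSeries
tail f n = f (suc n)

*ₛ-congʳ : ∀ h {f g} → f ≈ₛ g → f *ₛ h ≈ₛ g *ₛ h
*ₛ-congʳ h f≈g zero    = cong (λ a → a * h 0 + 0ℚ) (f≈g 0)
*ₛ-congʳ h f≈g (suc n) = cong₂ _+_ (cong (_* h (suc n)) (f≈g 0)) (*ₛ-congʳ h (f≈g ∘ suc) n)

*ₛ-distribʳ : ∀ h f g → (f +ₛ g) *ₛ h ≈ₛ f *ₛ h +ₛ g *ₛ h
*ₛ-distribʳ h f g zero    =
  solve 3 (λ a b c → (a :+ b) :* c :+ con 0ℚ := (a :* c :+ con 0ℚ) :+ (b :* c :+ con 0ℚ)) refl (f 0) (g 0) (h 0)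
*ₛ-distribʳ h f g (suc n) = begin
  (f 0 + g 0) * h (suc n) + ((tail f +ₛ tail g) *ₛ h) n
    ≡⟨ cong (λ z → (f 0 + g 0) * h (suc n) + z) (*ₛ-distribʳ h (tail f) (tail g) n) ⟩
  (f 0 + g 0) * h (suc n) + ((tail f *ₛ h) n + (tail g *ₛ h) n)
    ≡⟨ solve 5 (λ a b c d e → (a :+ b) :* c :+ (d :+ e) := (a :* c :+ d) :+ (b :* c :+ e)) refl
         (f 0) (g 0) (h (suc n)) ((tail f *ₛ h) n) ((tail g *ₛ h) n) ⟩
  (f *ₛ h +ₛ g *ₛ h) (suc n) ∎

*ₛ-scaleˡ : ∀ a f g n → ((λ k → a * f k) *ₛ g) n ≡ a * (f *ₛ g) n
*ₛ-scaleˡ a f g zero    =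
  solve 3 (λ a b c → a :* b :* c :+ con 0ℚ := a :* (b :* c :+ con 0ℚ)) refl a (f 0) (g 0)
*ₛ-scaleˡ a f g (suc n) = trans
  (cong (λ z → a * f 0 * g (suc n) + z) (*ₛ-scaleˡ a (tail f) g n))
  (solve 4 (λ a b c d → a :* b :* c :+ a :* d := a :* (b :* c :+ d)) refl
    a (f 0) (g (suc n)) ((tail f *ₛ g) n))

*ₛ-zeroˡ : ∀ {f} g → (∀ n → f n ≡ 0ℚ) → ∀ n → (f *ₛ g) n ≡ 0ℚ
*ₛ-zeroˡ g f≡0 zero    = trans (cong (λ a → a * g 0 + 0ℚ) (f≡0 0))
  (solve 1 (λ b → con 0ℚ :* b :+ con 0ℚ := con 0ℚ) refl (g 0))
*ₛ-zeroˡ g f≡0 (suc n) = trans (cong₂ (λ a z → a * g (suc n) + z) (f≡0 0) (*ₛ-zeroˡ g (f≡0 ∘ suc) n))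
  (solve 1 (λ b → con 0ℚ :* b :+ con 0ℚ := con 0ℚ) refl (g (suc n)))

-- The same recursion, taken in the second factor.
*ₛ-sucʳ : ∀ f g n → (f *ₛ g) (suc n) ≡ g 0 * f (suc n) + (f *ₛ tail g) n
*ₛ-sucʳ f g zero    =
  solve 4 (λ a b c d → a :* b :+ (c :* d :+ con 0ℚ) := d :* c :+ (a :* b :+ con 0ℚ)) refl
    (f 0) (g 1) (f 1) (g 0)
*ₛ-sucʳ f g (suc n) = trans
  (cong (λ z → f 0 * g (2 ℕ.+ n) + z) (*ₛ-sucʳ (tail f) g n))
  (solve 5 (λ a b c d e → a :* b :+ (c :* d :+ e) := c :* d :+ (a :* b :+ e)) refl
    (f 0) (g (2 ℕ.+ n)) (g 0) (f (2 ℕ.+ n)) ((tail f *ₛ tail g) n))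

*ₛ-comm : ∀ f g → f *ₛ g ≈ₛ g *ₛ f
*ₛ-comm f g zero    = cong (_+ 0ℚ) (*-comm (f 0) (g 0))
*ₛ-comm f g (suc n) = trans (cong (λ z → f 0 * g (suc n) + z) (*ₛ-comm (tail f) g n))
                            (sym (*ₛ-sucʳ g f n))

*ₛ-assoc : ∀ f g h → (f *ₛ g) *ₛ h ≈ₛ f *ₛ (g *ₛ h)
*ₛ-assoc f g h zero    =
  solve 3 (λ a b c → (a :* b :+ con 0ℚ) :* c :+ con 0ℚ := a :* (b :* c :+ con 0ℚ) :+ con 0ℚ) refl
    (f 0) (g 0) (h 0)
*ₛ-assoc f g h (suc n) = begin
  (f 0 * g 0 + 0ℚ) * h (suc n) + (((λ k → f 0 * g (suc k)) +ₛ tail f *ₛ g) *ₛ h) n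
    ≡⟨ cong (λ z → (f 0 * g 0 + 0ℚ) * h (suc n) + z)
         (trans (*ₛ-distribʳ h (λ k → f 0 * g (suc k)) (tail f *ₛ g) n)
                (cong₂ _+_ (*ₛ-scaleˡ (f 0) (tail g) h n) (*ₛ-assoc (tail f) g h n))) ⟩
  (f 0 * g 0 + 0ℚ) * h (suc n) + (f 0 * (tail g *ₛ h) n + (tail f *ₛ (g *ₛ h)) n)
    ≡⟨ solve 5 (λ a b c d e → (a :* b :+ con 0ℚ) :* c :+ (a :* d :+ e) := a :* (b :* c :+ d) :+ e) refl
         (f 0) (g 0) (h (suc n)) ((tail g *ₛ h) n) ((tail f *ₛ (g *ₛ h)) n) ⟩
  (f *ₛ (g *ₛ h)) (suc n) ∎

const-*ₛ : ∀ c f n → (const c *ₛ f) n ≡ fromℕℚ c * f n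
const-*ₛ c f zero    = ℚ.+-identityʳ (fromℕℚ c * f 0)
const-*ₛ c f (suc n) = trans
  (cong (λ z → fromℕℚ c * f (suc n) + z) (*ₛ-zeroˡ f (λ _ → refl) n))
  (ℚ.+-identityʳ (fromℕℚ c * f (suc n)))

x-*ₛ : ∀ f n → (x *ₛ f) (suc n) ≡ f n
x-*ₛ f n = begin
  0ℚ * f (suc n) + (tail x *ₛ f) n  ≡⟨ cong₂ _+_ (*-zeroˡ (f (suc n))) (*ₛ-congʳ f tail-x n) ⟩
  0ℚ + (const 1 *ₛ f) n             ≡⟨ ℚ.+-identityˡ ((const 1 *ₛ f) n) ⟩
  (const 1 *ₛ f) n                  ≡⟨ const-*ₛ 1 f n ⟩
  1ℚ * f n                          ≡⟨ *-identityˡ (f n) ⟩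
  f n                               ∎
  where
  tail-x : tail x ≈ₛ const 1
  tail-x zero    = refl
  tail-x (suc _) = refl

-- Multiplication by a polynomial 1 + a x, where a = g 1.
linear-*ₛ : ∀ g f → g 0 ≡ 1ℚ → (∀ n → g (2 ℕ.+ n) ≡ 0ℚ) → ∀ n →
            (g *ₛ f) (suc n) ≡ f (suc n) + g 1 * f n
linear-*ₛ g f g0≡1 g≡0 n = trans
  (cong₂ _+_ (trans (cong (_* f (suc n)) g0≡1) (*-identityˡ (f (suc n)))) (constant n)) refl
  where
  constant : ∀ n → (tail g *ₛ f) n ≡ g 1 * f n
  constant zero    = ℚ.+-identityʳ (g 1 * f 0)
  constant (suc n) = trans (cong (λ z → g 1 * f (suc n) + z) (*ₛ-zeroˡ f g≡0 n))
                           (ℚ.+-identityʳ (g 1 * f (suc n)))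

-- A product of polynomials of degrees below a and below b has degree below a + b.
*ₛ-degree : ∀ a b f g → (∀ n → f (a ℕ.+ n) ≡ 0ℚ) → (∀ n → g (b ℕ.+ n) ≡ 0ℚ) →
            ∀ n → (f *ₛ g) (a ℕ.+ (b ℕ.+ n)) ≡ 0ℚ
*ₛ-degree zero    b f g f≡0 g≡0 n = *ₛ-zeroˡ g f≡0 (b ℕ.+ n)
*ₛ-degree (suc a) b f g f≡0 g≡0 n = trans
  (cong₂ (λ u z → f 0 * u + z)
    (trans (cong g index) (g≡0 (suc a ℕ.+ n)))
    (*ₛ-degree a b (tail f) g f≡0 g≡0 n))
  (trans (ℚ.+-identityʳ (f 0 * 0ℚ)) (*-zeroʳ (f 0)))
  where
  index : suc a ℕ.+ (b ℕ.+ n) ≡ b ℕ.+ (suc a ℕ.+ n)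
  index = trans (sym (ℕ.+-assoc (suc a) b n)) (trans (cong (ℕ._+ n) (ℕ.+-comm (suc a) b)) (ℕ.+-assoc b (suc a) n))

-- The Catalan series and the first summand

-- The generating function of the ballot numbers ballot k r over k.
ballotSeries : ℕ → PowerSeries
ballotSeries r k = fromℕℚ (ballot k r)

-- As the (r + 1)-st and (s + 1)-st powers of the Catalan series, these multiply by
-- adding exponents.  The induction uses only the defining recursion of ballot.
ballotSeries-* : ∀ r s → ballotSeries r *ₛ ballotSeries s ≈ₛ ballotSeries (suc (r ℕ.+ s))
ballotSeries-* r       s zero    = refl
ballotSeries-* zero    s (suc n) = begin
  1ℚ * fromℕℚ (ballot (suc n) s) + (ballotSeries 1 *ₛ ballotSeries s) n
    ≡⟨ cong₂ _+_ (*-identityˡ (fromℕℚ (ballot (suc n) s))) (ballotSeries-* 1 s n) ⟩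
  fromℕℚ (ballot (suc n) s) + fromℕℚ (ballot n (2 ℕ.+ s))
    ≡⟨ fromℕℚ-+ (ballot (suc n) s) (ballot n (2 ℕ.+ s)) ⟨
  fromℕℚ (ballot (suc n) (suc s)) ∎
ballotSeries-* (suc r) s (suc n) = begin
  1ℚ * fromℕℚ (ballot (suc n) s) + (tail (ballotSeries (suc r)) *ₛ ballotSeries s) n
    ≡⟨ cong (λ z → 1ℚ * fromℕℚ (ballot (suc n) s) + z) split ⟩
  1ℚ * fromℕℚ (ballot (suc n) s)
    + ((tail (ballotSeries r) *ₛ ballotSeries s) n + (ballotSeries (2 ℕ.+ r) *ₛ ballotSeries s) n)
    ≡⟨ ℚ.+-assoc (1ℚ * fromℕℚ (ballot (suc n) s)) ((tail (ballotSeries r) *ₛ ballotSeries s) n) _ ⟨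
  (ballotSeries r *ₛ ballotSeries s) (suc n) + (ballotSeries (2 ℕ.+ r) *ₛ ballotSeries s) n
    ≡⟨ cong₂ _+_ (ballotSeries-* r s (suc n)) (ballotSeries-* (2 ℕ.+ r) s n) ⟩
  fromℕℚ (ballot (suc n) (suc (r ℕ.+ s))) + fromℕℚ (ballot n (3 ℕ.+ (r ℕ.+ s)))
    ≡⟨ fromℕℚ-+ (ballot (suc n) (suc (r ℕ.+ s))) (ballot n (3 ℕ.+ (r ℕ.+ s))) ⟨
  fromℕℚ (ballot (suc n) (2 ℕ.+ (r ℕ.+ s))) ∎
  where
  split : (tail (ballotSeries (suc r)) *ₛ ballotSeries s) n
          ≡ (tail (ballotSeries r) *ₛ ballotSeries s) n + (ballotSeries (2 ℕ.+ r) *ₛ ballotSeries s) n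
  split = trans
    (*ₛ-congʳ (ballotSeries s) {tail (ballotSeries (suc r))} {tail (ballotSeries r) +ₛ ballotSeries (2 ℕ.+ r)}
      (λ k → fromℕℚ-+ (ballot (suc k) r) (ballot k (2 ℕ.+ r))) n)
    (*ₛ-distribʳ (ballotSeries s) (tail (ballotSeries r)) (ballotSeries (2 ℕ.+ r)) n)

catalanSeries : PowerSeries
catalanSeries = ballotSeries 0

-- The series 1 - 2xC, where C is the Catalan series.
√1-4x : PowerSeries
√1-4x zero    = 1ℚ
√1-4x (suc n) = (- fromℕℚ 2) * catalanSeries n

-- C (1 - 2xC) = C - 2xC² = C - 2(C - 1) = 2 - C.
catalan-*-√ : ∀ n → (catalanSeries *ₛ √1-4x) (suc n) ≡ - catalanSeries (suc n)
catalan-*-√ n = begin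
  (catalanSeries *ₛ √1-4x) (suc n)
    ≡⟨ *ₛ-comm catalanSeries √1-4x (suc n) ⟩
  1ℚ * catalanSeries (suc n) + (tail √1-4x *ₛ catalanSeries) n
    ≡⟨ cong (λ z → 1ℚ * catalanSeries (suc n) + z)
         (trans (*ₛ-scaleˡ (- fromℕℚ 2) catalanSeries catalanSeries n)
                (cong (λ z → (- fromℕℚ 2) * z) (ballotSeries-* 0 0 n))) ⟩
  1ℚ * catalanSeries (suc n) + (- fromℕℚ 2) * catalanSeries (suc n)
    ≡⟨ solve 1 (λ c → con 1ℚ :* c :+ con (- fromℕℚ 2) :* c := :- c) refl (catalanSeries (suc n)) ⟩
  - catalanSeries (suc n) ∎

isSqrt : IsSqrt √1-4x (const 1 -ₛ const 4 *ₛ x)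
isSqrt = refl , square
  where
  square : √1-4x *ₛ √1-4x ≈ₛ const 1 -ₛ const 4 *ₛ x
  square 0 = refl
  square 1 = refl
  square (suc (suc n)) = begin
    1ℚ * ((- fromℕℚ 2) * c) + (tail √1-4x *ₛ √1-4x) (suc n)
      ≡⟨ cong (λ z → 1ℚ * ((- fromℕℚ 2) * c) + z)
           (trans (*ₛ-scaleˡ (- fromℕℚ 2) catalanSeries √1-4x (suc n))
                  (cong (λ z → (- fromℕℚ 2) * z) (catalan-*-√ n))) ⟩
    1ℚ * ((- fromℕℚ 2) * c) + (- fromℕℚ 2) * - c
      ≡⟨ solve 1 (λ c → con 1ℚ :* (con (- fromℕℚ 2) :* c) :+ con (- fromℕℚ 2) :* :- c := con 0ℚ) refl c ⟩
    0ℚ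
      ≡⟨ cong (λ z → 0ℚ - z) (const-*ₛ 4 x (2 ℕ.+ n)) ⟨
    (const 1 -ₛ const 4 *ₛ x) (2 ℕ.+ n) ∎
    where
    c = catalanSeries (suc n)

1-x : PowerSeries
1-x = const 1 -ₛ x

1-x-*ₛ : ∀ f n → (1-x *ₛ f) (suc n) ≡ f (suc n) - f n
1-x-*ₛ f n = trans (linear-*ₛ 1-x f refl (λ _ → refl) n)
  (solve 2 (λ a b → a :+ con (- 1ℚ) :* b := a :- b) refl (f (suc n)) (f n))

isQuotient-partialSums :
  IsQuotient partialSums (const 1 -ₛ √1-4x) (const 2 *ₛ x *ₛ (const 1 -ₛ x))
isQuotient-partialSums = (λ z → contradiction (z 1) λ ()) , product
  where
  regroup : partialSums *ₛ (const 2 *ₛ x *ₛ 1-x) ≈ₛ const 2 *ₛ (x *ₛ (1-x *ₛ partialSums))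
  regroup n = begin
    (partialSums *ₛ (const 2 *ₛ x *ₛ 1-x)) n    ≡⟨ *ₛ-comm partialSums (const 2 *ₛ x *ₛ 1-x) n ⟩
    (const 2 *ₛ x *ₛ 1-x *ₛ partialSums) n      ≡⟨ *ₛ-assoc (const 2 *ₛ x) 1-x partialSums n ⟩
    (const 2 *ₛ x *ₛ (1-x *ₛ partialSums)) n    ≡⟨ *ₛ-assoc (const 2) x (1-x *ₛ partialSums) n ⟩
    (const 2 *ₛ (x *ₛ (1-x *ₛ partialSums))) n  ∎
  step : ∀ n → (1-x *ₛ partialSums) n ≡ catalanSeries n
  step zero    = refl
  step (suc n) = begin
    (1-x *ₛ partialSums) (suc n)                         ≡⟨ 1-x-*ₛ partialSums n ⟩
    partialSums (suc n) - partialSums n                ≡⟨ cong (_- partialSums n) (∑-last catalanTerm (suc n)) ⟩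
    partialSums n + catalanTerm (suc n) - partialSums n
      ≡⟨ solve 2 (λ p c → p :+ c :- p := c) refl (partialSums n) (catalanTerm (suc n)) ⟩
    catalanTerm (suc n)                                ≡⟨ catalanTerm-catalan (suc n) ⟩
    catalanSeries (suc n)                              ∎
  product : partialSums *ₛ (const 2 *ₛ x *ₛ 1-x) ≈ₛ const 1 -ₛ √1-4x
  product zero    = refl
  product (suc n) = begin
    (partialSums *ₛ (const 2 *ₛ x *ₛ 1-x)) (suc n)      ≡⟨ regroup (suc n) ⟩
    (const 2 *ₛ (x *ₛ (1-x *ₛ partialSums))) (suc n)    ≡⟨ const-*ₛ 2 (x *ₛ (1-x *ₛ partialSums)) (suc n) ⟩
    fromℕℚ 2 * (x *ₛ (1-x *ₛ partialSums)) (suc n)      ≡⟨ cong (λ z → fromℕℚ 2 * z) (x-*ₛ (1-x *ₛ partialSums) n) ⟩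
    fromℕℚ 2 * (1-x *ₛ partialSums) n                   ≡⟨ cong (λ z → fromℕℚ 2 * z) (step n) ⟩
    fromℕℚ 2 * catalanSeries n
      ≡⟨ solve 1 (λ c → con (fromℕℚ 2) :* c := con 0ℚ :- con (- fromℕℚ 2) :* c) refl (catalanSeries n) ⟩
    0ℚ - √1-4x (suc n)                                ∎

-- The rational summand

-- The part 2^n - 1 - n³/6 - 11n/6 of the counting formula, with t in place of 2^n.
correction : ℚ → ℚ → ℚ
correction ν t = t - 1ℚ - (+ 1 / 6) * (ν * (ν * ν)) - (+ 11 / 6) * ν

-- The coefficients of the second, rational summand.  At 0 the formula would give
-- 0; the coefficient is -1 because R has no constant term while the first
-- summand has constant term 1.
correctionSeries : PowerSeries
correctionSeries zero      = - 1ℚ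
correctionSeries n@(suc _) = correction (fromℕℚ n) (fromℕℚ (2 ℕ.^ n))

fromℕℚ-cube : ∀ n → fromℕℚ (n ℕ.^ 3) ≡ fromℕℚ n * (fromℕℚ n * fromℕℚ n)
fromℕℚ-cube n = begin
  fromℕℚ (n ℕ.^ 3)                           ≡⟨ fromℕℚ-* n (n ℕ.* (n ℕ.* 1)) ⟩
  fromℕℚ n * fromℕℚ (n ℕ.* (n ℕ.* 1))        ≡⟨ cong (λ z → fromℕℚ n * fromℕℚ (n ℕ.* z)) (ℕ.*-identityʳ n) ⟩
  fromℕℚ n * fromℕℚ (n ℕ.* n)                ≡⟨ cong (λ z → fromℕℚ n * z) (fromℕℚ-* n n) ⟩
  fromℕℚ n * (fromℕℚ n * fromℕℚ n)           ∎

R-decomposition : R ≈ₛ partialSums +ₛ correctionSeries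
R-decomposition zero      = refl
R-decomposition n@(suc k) = begin
  fromℕℚ (∣I∣ k patterns)
    ≡⟨ counting-formula n (s≤s z≤n) ⟩
  partialSums n - 1ℚ - (+ 1 / 6) * fromℕℚ (n ℕ.^ 3) - (+ 11 / 6) * ν + t
    ≡⟨ cong (λ c → partialSums n - 1ℚ - (+ 1 / 6) * c - (+ 11 / 6) * ν + t) (fromℕℚ-cube n) ⟩
  partialSums n - 1ℚ - (+ 1 / 6) * (ν * (ν * ν)) - (+ 11 / 6) * ν + t
    ≡⟨ solve 4 (λ p c l t → p :- con 1ℚ :- c :- l :+ t := p :+ (t :- con 1ℚ :- c :- l)) refl
         (partialSums n) ((+ 1 / 6) * (ν * (ν * ν))) ((+ 11 / 6) * ν) t ⟩
  partialSums n + correction ν t ∎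
  where
  ν = fromℕℚ n
  t = fromℕℚ (2 ℕ.^ n)

1-2x : PowerSeries
1-2x = const 1 -ₛ const 2 *ₛ x

1-2x-*ₛ : ∀ f n → (1-2x *ₛ f) (suc n) ≡ f (suc n) - fromℕℚ 2 * f n
1-2x-*ₛ f n = trans
  (linear-*ₛ 1-2x f refl (λ n → cong (λ z → 0ℚ - z) (const-*ₛ 2 x (2 ℕ.+ n))) n)
  (solve 2 (λ a b → a :+ con (- fromℕℚ 2) :* b := a :- con (fromℕℚ 2) :* b) refl (f (suc n)) (f n))

denominator-*ₛ : ∀ f → f *ₛ (1-x ^ₛ 4 *ₛ 1-2x) ≈ₛ 1-x *ₛ (1-x *ₛ (1-x *ₛ (1-x *ₛ (1-2x *ₛ f))))
denominator-*ₛ f n = begin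
  (f *ₛ (1-x ^ₛ 4 *ₛ 1-2x)) n     ≡⟨ *ₛ-comm f (1-x ^ₛ 4 *ₛ 1-2x) n ⟩
  (1-x ^ₛ 4 *ₛ 1-2x *ₛ f) n       ≡⟨ *ₛ-assoc (1-x ^ₛ 4) 1-2x f n ⟩
  (1-x ^ₛ 4 *ₛ (1-2x *ₛ f)) n     ≡⟨ power 4 n ⟩
  apply 4 n                       ∎
  where
  apply : ℕ → PowerSeries
  apply zero    = 1-2x *ₛ f
  apply (suc k) = 1-x *ₛ apply k
  power : ∀ k → 1-x ^ₛ k *ₛ (1-2x *ₛ f) ≈ₛ apply k
  power zero    n = trans (const-*ₛ 1 (1-2x *ₛ f) n) (*-identityˡ ((1-2x *ₛ f) n))
  power (suc k) n = begin
    (1-x *ₛ 1-x ^ₛ k *ₛ (1-2x *ₛ f)) n   ≡⟨ *ₛ-assoc 1-x (1-x ^ₛ k) (1-2x *ₛ f) n ⟩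
    (1-x *ₛ (1-x ^ₛ k *ₛ (1-2x *ₛ f))) n ≡⟨ *ₛ-congˡ 1-x (power k) n ⟩
    (1-x *ₛ apply k) n                   ∎
    where
    *ₛ-congˡ : ∀ h {f g} → f ≈ₛ g → h *ₛ f ≈ₛ h *ₛ g
    *ₛ-congˡ h {f} {g} f≈g n = trans (*ₛ-comm h f n) (trans (*ₛ-congʳ h {f} {g} f≈g n) (*ₛ-comm g h n))

-- The two factors of the numerator of the rational summand, of degrees 2 and 3.
numerator₁ numerator₂ : PowerSeries
numerator₁ = const 2 *ₛ x ^ₛ 2 -ₛ const 2 *ₛ x +ₛ const 1
numerator₂ = x ^ₛ 3 -ₛ const 2 *ₛ x ^ₛ 2 +ₛ const 3 *ₛ x -ₛ const 1

x^-above : ∀ k n → (x ^ₛ k) (suc k ℕ.+ n) ≡ 0ℚ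
x^-above zero    n = refl
x^-above (suc k) n = trans (x-*ₛ (x ^ₛ k) (suc k ℕ.+ n)) (x^-above k n)

scaled-above : ∀ c f n → f n ≡ 0ℚ → (const c *ₛ f) n ≡ 0ℚ
scaled-above c f n f≡0 = trans (const-*ₛ c f n) (trans (cong (λ z → fromℕℚ c * z) f≡0) (*-zeroʳ (fromℕℚ c)))

numerator₁-above : ∀ n → numerator₁ (3 ℕ.+ n) ≡ 0ℚ
numerator₁-above n = cong₂ (λ a b → a - b + 0ℚ)
  (scaled-above 2 (x ^ₛ 2) (3 ℕ.+ n) (x^-above 2 n))
  (scaled-above 2 x (3 ℕ.+ n) refl)

numerator₂-above : ∀ n → numerator₂ (4 ℕ.+ n) ≡ 0ℚ
numerator₂-above n = trans (cong₂ (λ a b → a - b + (const 3 *ₛ x) (4 ℕ.+ n) - 0ℚ)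
    (x^-above 3 n)
    (scaled-above 2 (x ^ₛ 2) (4 ℕ.+ n) (x^-above 2 (suc n))))
  (cong (λ a → 0ℚ - 0ℚ + a - 0ℚ) (scaled-above 3 x (4 ℕ.+ n) refl))

-- The coefficients are those of (1 - x)⁴(1 - 2x).
denominator-expansion : ∀ f n → (1-x *ₛ (1-x *ₛ (1-x *ₛ (1-x *ₛ (1-2x *ₛ f))))) (5 ℕ.+ n)
  ≡ f (5 ℕ.+ n) - fromℕℚ 6 * f (4 ℕ.+ n) + fromℕℚ 14 * f (3 ℕ.+ n)
    - fromℕℚ 16 * f (2 ℕ.+ n) + fromℕℚ 9 * f (1 ℕ.+ n) - fromℕℚ 2 * f n
denominator-expansion f = level₅
  where
  f₁ = 1-2x *ₛ f
  f₂ = 1-x *ₛ f₁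
  f₃ = 1-x *ₛ f₂
  f₄ = 1-x *ₛ f₃
  f₅ = 1-x *ₛ f₄
  level₂ : ∀ n → f₂ (2 ℕ.+ n) ≡ f (2 ℕ.+ n) - fromℕℚ 3 * f (1 ℕ.+ n) + fromℕℚ 2 * f n
  level₂ n = trans (trans (1-x-*ₛ f₁ (1 ℕ.+ n)) (cong₂ _-_ (1-2x-*ₛ f (1 ℕ.+ n)) (1-2x-*ₛ f n)))
    (solve 3 (λ a b c → (a :- con (fromℕℚ 2) :* b) :- (b :- con (fromℕℚ 2) :* c)
                        := a :- con (fromℕℚ 3) :* b :+ con (fromℕℚ 2) :* c) refl
      (f (2 ℕ.+ n)) (f (1 ℕ.+ n)) (f n))
  level₃ : ∀ n → f₃ (3 ℕ.+ n) ≡ f (3 ℕ.+ n) - fromℕℚ 4 * f (2 ℕ.+ n) + fromℕℚ 5 * f (1 ℕ.+ n) - fromℕℚ 2 * f n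
  level₃ n = trans (trans (1-x-*ₛ f₂ (2 ℕ.+ n)) (cong₂ _-_ (level₂ (1 ℕ.+ n)) (level₂ n)))
    (solve 4 (λ a b c d →
        (a :- con (fromℕℚ 3) :* b :+ con (fromℕℚ 2) :* c) :- (b :- con (fromℕℚ 3) :* c :+ con (fromℕℚ 2) :* d)
        := a :- con (fromℕℚ 4) :* b :+ con (fromℕℚ 5) :* c :- con (fromℕℚ 2) :* d) refl
      (f (3 ℕ.+ n)) (f (2 ℕ.+ n)) (f (1 ℕ.+ n)) (f n))
  level₄ : ∀ n → f₄ (4 ℕ.+ n) ≡ f (4 ℕ.+ n) - fromℕℚ 5 * f (3 ℕ.+ n) + fromℕℚ 9 * f (2 ℕ.+ n)
                               - fromℕℚ 7 * f (1 ℕ.+ n) + fromℕℚ 2 * f n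
  level₄ n = trans (trans (1-x-*ₛ f₃ (3 ℕ.+ n)) (cong₂ _-_ (level₃ (1 ℕ.+ n)) (level₃ n)))
    (solve 5 (λ a b c d e →
        (a :- con (fromℕℚ 4) :* b :+ con (fromℕℚ 5) :* c :- con (fromℕℚ 2) :* d)
          :- (b :- con (fromℕℚ 4) :* c :+ con (fromℕℚ 5) :* d :- con (fromℕℚ 2) :* e)
        := a :- con (fromℕℚ 5) :* b :+ con (fromℕℚ 9) :* c :- con (fromℕℚ 7) :* d :+ con (fromℕℚ 2) :* e) refl
      (f (4 ℕ.+ n)) (f (3 ℕ.+ n)) (f (2 ℕ.+ n)) (f (1 ℕ.+ n)) (f n))
  level₅ : ∀ n → f₅ (5 ℕ.+ n) ≡ f (5 ℕ.+ n) - fromℕℚ 6 * f (4 ℕ.+ n) + fromℕℚ 14 * f (3 ℕ.+ n)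
                               - fromℕℚ 16 * f (2 ℕ.+ n) + fromℕℚ 9 * f (1 ℕ.+ n) - fromℕℚ 2 * f n
  level₅ n = trans (trans (1-x-*ₛ f₄ (4 ℕ.+ n)) (cong₂ _-_ (level₄ (1 ℕ.+ n)) (level₄ n)))
    (solve 6 (λ a b c d e g →
        (a :- con (fromℕℚ 5) :* b :+ con (fromℕℚ 9) :* c :- con (fromℕℚ 7) :* d :+ con (fromℕℚ 2) :* e)
          :- (b :- con (fromℕℚ 5) :* c :+ con (fromℕℚ 9) :* d :- con (fromℕℚ 7) :* e :+ con (fromℕℚ 2) :* g)
        := a :- con (fromℕℚ 6) :* b :+ con (fromℕℚ 14) :* c :- con (fromℕℚ 16) :* d
             :+ con (fromℕℚ 9) :* e :- con (fromℕℚ 2) :* g) refl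
      (f (5 ℕ.+ n)) (f (4 ℕ.+ n)) (f (3 ℕ.+ n)) (f (2 ℕ.+ n)) (f (1 ℕ.+ n)) (f n))

correction-shift : ∀ i m → correction (fromℕℚ (i ℕ.+ m)) (fromℕℚ (2 ℕ.^ (i ℕ.+ m)))
                           ≡ correction (fromℕℚ i + fromℕℚ m) (fromℕℚ (2 ℕ.^ i) * fromℕℚ (2 ℕ.^ m))
correction-shift i m = cong₂ correction (fromℕℚ-+ i m)
  (trans (cong fromℕℚ (ℕ.^-distribˡ-+-* 2 i m)) (fromℕℚ-* (2 ℕ.^ i) (2 ℕ.^ m)))

-- A cubic polynomial in n is annihilated by (1 - x)⁴ and 2^n by 1 - 2x.  The
-- constants 2, 4, ..., 32 are the powers of 2 that t acquires.
correction-recurrence : ∀ ν t →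
  correction (fromℕℚ 5 + ν) (fromℕℚ 32 * t) - fromℕℚ 6 * correction (fromℕℚ 4 + ν) (fromℕℚ 16 * t)
    + fromℕℚ 14 * correction (fromℕℚ 3 + ν) (fromℕℚ 8 * t) - fromℕℚ 16 * correction (fromℕℚ 2 + ν) (fromℕℚ 4 * t)
    + fromℕℚ 9 * correction (fromℕℚ 1 + ν) (fromℕℚ 2 * t) - fromℕℚ 2 * correction ν t ≡ 0ℚ
correction-recurrence = solve 2 (λ ν t →
  p (con (fromℕℚ 5) :+ ν) (con (fromℕℚ 32) :* t)
    :- con (fromℕℚ 6) :* p (con (fromℕℚ 4) :+ ν) (con (fromℕℚ 16) :* t)
    :+ con (fromℕℚ 14) :* p (con (fromℕℚ 3) :+ ν) (con (fromℕℚ 8) :* t)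
    :- con (fromℕℚ 16) :* p (con (fromℕℚ 2) :+ ν) (con (fromℕℚ 4) :* t)
    :+ con (fromℕℚ 9) :* p (con (fromℕℚ 1) :+ ν) (con (fromℕℚ 2) :* t)
    :- con (fromℕℚ 2) :* p ν t
  := con 0ℚ) refl
  where
  p : ∀ {n} → Polynomial n → Polynomial n → Polynomial n
  p ν t = t :- con 1ℚ :- con (+ 1 / 6) :* (ν :* (ν :* ν)) :- con (+ 11 / 6) :* ν

isQuotient-correction : IsQuotient correctionSeries (numerator₁ *ₛ numerator₂) (1-x ^ₛ 4 *ₛ 1-2x)
isQuotient-correction = (λ z → contradiction (z 0) λ ()) , λ n → trans (denominator-*ₛ correctionSeries n) (product n)
  where
  product : 1-x *ₛ (1-x *ₛ (1-x *ₛ (1-x *ₛ (1-2x *ₛ correctionSeries)))) ≈ₛ numerator₁ *ₛ numerator₂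
  -- The numerator has degree 5 and the formula for the coefficients of the
  -- correction starts at 1, so the recurrence settles the indices from 6 on.
  product 0 = refl
  product 1 = refl
  product 2 = refl
  product 3 = refl
  product 4 = refl
  product 5 = refl
  product (suc (suc (suc (suc (suc (suc n)))))) = trans vanish (sym (numerator n))
    where
    f = correctionSeries
    m = suc n
    numerator : ∀ n → (numerator₁ *ₛ numerator₂) (6 ℕ.+ n) ≡ 0ℚ
    numerator zero    = refl
    numerator (suc n) = *ₛ-degree 3 4 numerator₁ numerator₂ numerator₁-above numerator₂-above n
    vanish : (1-x *ₛ (1-x *ₛ (1-x *ₛ (1-x *ₛ (1-2x *ₛ f))))) (6 ℕ.+ n) ≡ 0ℚ
    vanish = begin
      (1-x *ₛ (1-x *ₛ (1-x *ₛ (1-x *ₛ (1-2x *ₛ f))))) (5 ℕ.+ m)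
        ≡⟨ denominator-expansion f m ⟩
      f (5 ℕ.+ m) - fromℕℚ 6 * f (4 ℕ.+ m) + fromℕℚ 14 * f (3 ℕ.+ m)
        - fromℕℚ 16 * f (2 ℕ.+ m) + fromℕℚ 9 * f (1 ℕ.+ m) - fromℕℚ 2 * f m
        ≡⟨ cong₂ (λ a b → a + fromℕℚ 9 * b - fromℕℚ 2 * f m)
             (cong₂ _-_
               (cong₂ (λ a b → a + fromℕℚ 14 * b)
                 (cong₂ (λ a b → a - fromℕℚ 6 * b) (correction-shift 5 m) (correction-shift 4 m))
                 (correction-shift 3 m))
               (cong (λ a → fromℕℚ 16 * a) (correction-shift 2 m)))
             (correction-shift 1 m) ⟩
      correction (fromℕℚ 5 + ν) (fromℕℚ 32 * t) - fromℕℚ 6 * correction (fromℕℚ 4 + ν) (fromℕℚ 16 * t)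
        + fromℕℚ 14 * correction (fromℕℚ 3 + ν) (fromℕℚ 8 * t) - fromℕℚ 16 * correction (fromℕℚ 2 + ν) (fromℕℚ 4 * t)
        + fromℕℚ 9 * correction (fromℕℚ 1 + ν) (fromℕℚ 2 * t) - fromℕℚ 2 * correction ν t
        ≡⟨ correction-recurrence ν t ⟩
      0ℚ ∎
      where
      ν = fromℕℚ m
      t = fromℕℚ (2 ℕ.^ m)

theorem4p4 : (Σ[ s ∈ PowerSeries ] Σ[ p ∈ PowerSeries ] Σ[ q ∈ PowerSeries ]
    ( IsSqrt s (const 1 -ₛ const 4 *ₛ x)
    × IsQuotient p (const 1 -ₛ s) (const 2 *ₛ x *ₛ (const 1 -ₛ x))
    × IsQuotient q
    ( (const 2 *ₛ x ^ₛ 2 -ₛ const 2 *ₛ x +ₛ const 1)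
    *ₛ (x ^ₛ 3 -ₛ const 2 *ₛ x ^ₛ 2 +ₛ const 3 *ₛ x -ₛ const 1) )
    ( (const 1 -ₛ x) ^ₛ 4 *ₛ (const 1 -ₛ const 2 *ₛ x) )
    × R ≈ₛ p +ₛ q ))
    ×
    (∀ (n : ℕ) → 1 ≤ n →
    fromℕℚ (∣I∣ (pred n) patterns)
    ≡ ∑ {suc n} (λ k → (+ 1 / suc (toℕ k)) * fromℕℚ ((2 ℕ.* toℕ k) C toℕ k))
    - 1ℚ
    - (+ 1 / 6) * fromℕℚ (n ℕ.^ 3)
    - (+ 11 / 6) * fromℕℚ n
    + fromℕℚ (2 ℕ.^ n))
theorem4p4 =
  ( √1-4x , partialSums , correctionSeries
  , isSqrt , isQuotient-partialSums , isQuotient-correction , R-decomposition )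
  , counting-formula
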